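{- Let $n\ge 1$ and $k\ge 1$ be integers and let $\lambda=(\lambda_1\ge\dots\ge\lambda_n\ge 0)$ be a partition with at most $n$ parts. Let $g_\lambda^{n,k}$ be the coefficient of the Schur polynomial $s_\lambda(z_1,\dots,z_n)$ in the expansion of $V(z_1,\dots,z_n)^{2k}=\prod_{1\le i<j\le n}(z_i-z_j)^{2k}$ in the basis of Schur polynomials in $n$ variables. Then $$g_\lambda^{n,k}=(-1)^{\frac{n(n-1)}{2}}\,\mathfrak D_{\lambda,\underbrace{[0^n],\dots,[0^n]}_{2k+1\text{ times}}},$$ where $[0^n]=[0,\dots,0]\in\mathbb Z^n$.
   Context: For an even integer $2p$ and a tensor $\mathrm M=(M_{i_1,\dots,i_{2p}})_{1\le i_1,\dots,i_{2p}\le n}$, the hyperdeterminant is $$\mathrm{Det}(\mathrm M)=\frac1{n!}\sum_{\sigma_1,\dots,\sigma_{2p}\in\mathfrak S_n}\mathrm{sign}(\sigma_1\cdots\sigma_{2p})\prod_{i=1}^n M_{\sigma_1(i),\dots,\sigma_{2p}(i)},$$ where $\mathfrak S_n$ is the symmetric group. A vector $\lambda=[\lambda_1,\dots,\lambda_n]\in\mathbb Z^n$ is called decreasing if $\lambda_1\ge\dots\ge\lambda_n$. For $2p$ decreasing vectors $\lambda^{(1)},\dots,\lambda^{(2p)}\in\mathbb Z^n$, define the tensor with $2p$ indices $$\Delta_{\lambda^{(1)},\dots,\lambda^{(2p)}}=\left(\delta_{\lambda^{(1)}_{n-i_1+1}+\dots+\lambda^{(2p)}_{n-i_{2p}+1}+i_1+\dots+i_{2p},\,(2p-1)n+1}\right)_{1\le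 i_1,\dots,i_{2p}\le n}$$ ($\delta$ is the Kronecker delta) and $\mathfrak D_{\lambda^{(1)},\dots,\lambda^{(2p)}}=\mathrm{Det}(\Delta_{\lambda^{(1)},\dots,\lambda^{(2p)}})$. In the claim this is used with $2p=2k+2$. The Schur polynomial is $s_\lambda(z_1,\dots,z_n)=\det(z_i^{\lambda_{n-j+1}+j-1})_{1\le i,j\le n}/\det(z_i^{j-1})_{1\le i,j\le n}$. -}

module Defs where

open import Algebra.Bundles using (RawRing)
import Algebra.Definitions.RawSemiring as RawSemiringDefs
open import Data.Bool.Base using (if_then_else_)
open import Data.Fin.Base using (Fin; zero; suc; toℕ; opposite; punchIn)
open import Data.Fin.Permutation as Perm
  using (Permutation′; _⟨$⟩ʳ_; _∘ₚ_; insert; remove; insert-remove; insert-punchIn)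
import Data.Fin.Properties as Fin
open import Data.Integer.Base as ℤ using (ℤ; +_; 0ℤ; 1ℤ)
import Data.Integer.Properties as ℤ
open import Data.List.Base as List using (List; []; _∷_; _++_; cartesianProductWith; allFin)
open import Data.List.Membership.Propositional using (_∈_; _∉_)
open import Data.List.Membership.Propositional.Properties
  using (∈-allFin; ∈-cartesianProductWith⁺)
open import Data.List.Relation.Unary.All using ([])
open import Data.List.Relation.Unary.AllPairs using ([]; _∷_)
open import Data.List.Relation.Unary.Any using (here)
open import Data.List.Relation.Unary.Unique.Propositional using (Unique)
import Data.List.Relation.Unary.Unique.Propositional.Properties as Unique
import Data.List.Relation.Unary.Unique.Setoid as SetoidUnique
import Data.List.Relation.Unary.Unique.Setoid.Properties as SetoidUnique
open import Data.Nat.Base as ℕ using (ℕ; zero; suc; _!)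
import Data.Nat.Properties as ℕ
open import Data.Product.Base using (_×_; _,_; ∃-syntax)
open import Data.Rational.Base as ℚ using (ℚ; 0ℚ; 1ℚ)
open import Data.Vec.Base as Vec using (Vec; []; _∷_)
import Data.Vec.Properties as Vec
open import Data.Vec.Relation.Unary.Linked as Linked using (Linked; []; [-]; _∷_)
import Data.Vec.Relation.Unary.Linked.Properties as Linked
open import Level using (0ℓ)
open import Relation.Binary.Bundles using (Setoid)
open import Relation.Binary.PropositionalEquality
  using (_≡_; refl; sym; trans; cong; setoid)
open import Relation.Nullary.Decidable using (yes; no; does)

private
  variable
    m n : ℕ
    A : Set

-- Every element of 𝔖ₙ, exactly once: a permutation π of {0, …, n} is
-- determined by π 0 and by the permutation left after deleting 0 and π 0.
-- See `𝔖-complete` and `𝔖-unique`.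
𝔖 : ∀ n → List (Permutation′ n)
𝔖 zero    = Perm.id ∷ []
𝔖 (suc n) = cartesianProductWith (insert zero) (allFin (suc n)) (𝔖 n)

permutationSetoid : ℕ → Setoid 0ℓ 0ℓ
permutationSetoid n = record
  { Carrier       = Permutation′ n
  ; _≈_           = Perm._≈_
  ; isEquivalence = record
    { refl  = λ _ → refl
    ; sym   = λ π≈ρ i → sym (π≈ρ i)
    ; trans = λ π≈ρ ρ≈τ i → trans (π≈ρ i) (ρ≈τ i)
    }
  }

private
  insert-cong : ∀ i j {π ρ : Permutation′ n} → π Perm.≈ ρ → insert i j π Perm.≈ insert i j ρ
  insert-cong i j π≈ρ k with i Fin.≟ k
  ... | yes _ = refl
  ... | no  _ = cong (punchIn j) (π≈ρ _)

  insert-injective : ∀ {i j} {π ρ : Permutation′ n} →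
                     insert zero i π Perm.≈ insert zero j ρ → i ≡ j × π Perm.≈ ρ
  insert-injective {i = i} {π = π} {ρ} eq with refl ← eq zero =
    refl , λ k → Fin.punchIn-injective i _ _
      (trans (sym (insert-punchIn zero i π k))
        (trans (eq (suc k)) (insert-punchIn zero i ρ k)))

𝔖-complete : (π : Permutation′ n) → ∃[ ρ ] ρ ∈ 𝔖 n × ρ Perm.≈ π
𝔖-complete {zero}  π = Perm.id , here refl , λ ()
𝔖-complete {suc n} π =
  let ρ , ρ∈ , ρ≈ = 𝔖-complete (remove zero π)
      j = π ⟨$⟩ʳ zero
  in insert zero j ρ
   , ∈-cartesianProductWith⁺ (insert zero) (∈-allFin j) ρ∈
   , λ k → trans (insert-cong zero j ρ≈ k) (insert-remove zero π k)

𝔖-unique : ∀ n → SetoidUnique.Unique (permutationSetoid n) (𝔖 n)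
𝔖-unique zero    = [] ∷ []
𝔖-unique (suc n) = SetoidUnique.cartesianProductWith⁺
  (setoid (Fin (suc n))) (permutationSetoid n) (permutationSetoid (suc n))
  (insert zero) insert-injective (Unique.allFin⁺ (suc n)) (𝔖-unique n)

tuples : List A → ∀ m → List (Vec A m)
tuples xs zero    = [] ∷ []
tuples xs (suc m) = cartesianProductWith _∷_ xs (tuples xs m)

module RingNotation {c ℓ} (R : RawRing c ℓ) where
  open RawRing R
  open RawSemiringDefs rawSemiring public using (product; _^_)

  ∑ : List A → (A → Carrier) → Carrier
  ∑ xs f = List.foldr (λ x acc → f x + acc) 0# xs

  ∏ : (Fin n → Carrier) → Carrier
  ∏ = product

  ∏< : (Fin n → Fin n → Carrier) → Carrier
  ∏< f = ∏ λ i → ∏ λ j → if does (i Fin.<? j) then f i j else 1#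

  -- (−1) to the number of inversions of π.
  sign : Permutation′ n → Carrier
  sign π = ∏< λ i j → if does ((π ⟨$⟩ʳ j) Fin.<? (π ⟨$⟩ʳ i)) then - 1# else 1#

  det : (Fin n → Fin n → Carrier) → Carrier
  det {n} M = ∑ (𝔖 n) λ π → sign π * ∏ λ i → M i (π ⟨$⟩ʳ i)

module ℚ′ = RingNotation ℚ.+-*-rawRing

-- The hyperdeterminant of an order-m tensor.  The formula makes sense for
-- every m; the classical notion is the case of even m.
Det : ∀ n m → (Vec (Fin n) m → ℚ) → ℚ
Det n m M = ((1ℤ ℚ./ n !) {{n ℕ.!≢0}}) ℚ.*
  ∑ (tuples (𝔖 n) m) λ σs →
    sign (Vec.foldr′ _∘ₚ_ Perm.id σs) ℚ.* ∏ λ i → M (Vec.map (_⟨$⟩ʳ i) σs)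
  where open ℚ′

record Decreasing (n : ℕ) : Set where
  constructor decreasing
  field
    entries : Vec ℤ n
    sorted  : Linked ℤ._≥_ entries

-- The index set {1, …, n} is Fin n, whose element i stands for toℕ i + 1; the
-- index n − i + 1 is `opposite i`.
one-based : Fin n → ℤ
one-based i = + suc (toℕ i)

δ : ℤ → ℤ → ℚ
δ a b = if does (a ℤ.≟ b) then 1ℚ else 0ℚ

Δ : ∀ n m → Vec (Decreasing n) m → Vec (Fin n) m → ℚ
Δ n m λs is = δ (Vec.foldr′ ℤ._+_ 0ℤ (Vec.zipWith summand λs is))
                ((+ m ℤ.- 1ℤ) ℤ.* + n ℤ.+ 1ℤ)
  where
  summand : Decreasing n → Fin n → ℤ
  summand l i = Vec.lookup (Decreasing.entries l) (opposite i) ℤ.+ one-based i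

𝔇 : Vec (Decreasing n) m → ℚ
𝔇 {n} {m} λs = Det n m (Δ n m λs)

record Partition (n : ℕ) : Set where
  constructor partition
  field
    parts  : Vec ℕ n
    sorted : Linked ℕ._≥_ parts

toDecreasing : Partition n → Decreasing n
toDecreasing (partition parts sorted) =
  decreasing (Vec.map +_ parts) (Linked.map⁺ (Linked.map ℤ.+≤+ sorted))

zeros : ∀ n → Decreasing n
zeros n = decreasing (Vec.replicate n 0ℤ) (constant n)
  where
  constant : ∀ n → Linked ℤ._≥_ (Vec.replicate n 0ℤ)
  constant 0             = []
  constant 1             = [-]
  constant (suc (suc n)) = ℤ.≤-refl ∷ constant (suc n)

-- ℚ[z₁, …, zₙ].  A polynomial is a list of terms (coefficient , exponents), in
-- which a monomial may occur several times; equality is equality of all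
-- coefficients.
Polynomial : ℕ → Set
Polynomial n = List (ℚ × Vec ℕ n)

coefficient : Polynomial n → Vec ℕ n → ℚ
coefficient p α = ℚ′.∑ p λ (c , β) →
  if does (Vec.≡-dec ℕ._≟_ β α) then c else 0ℚ

const : ℚ → Polynomial n
const c = (c , Vec.replicate _ 0) ∷ []

z : Fin n → Polynomial n
z {n} i = (1ℚ , Vec.tabulate λ j → if does (i Fin.≟ j) then 1 else 0) ∷ []

polynomialRawRing : ℕ → RawRing 0ℓ 0ℓ
polynomialRawRing n = record
  { Carrier = Polynomial n
  ; _≈_     = λ p q → ∀ α → coefficient p α ≡ coefficient q α
  ; _+_     = _++_
  ; _*_     = cartesianProductWith λ (c , α) (d , β) → c ℚ.* d , Vec.zipWith ℕ._+_ α β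
  ; -_      = List.map λ (c , α) → ℚ.- c , α
  ; 0#      = []
  ; 1#      = const 1ℚ
  }

module _ {n : ℕ} where
  open RawRing (polynomialRawRing n)
  open RingNotation (polynomialRawRing n)

  V : Polynomial n
  V = ∏< λ i j → z i + - z j

  -- s is the quotient of the two determinants.  It exists because the
  -- alternating dividend is divisible by the Vandermonde determinant, and is
  -- unique up to ≈ because ℚ[z₁, …, zₙ] is an integral domain.  With
  -- one-based columns the exponent j − 1 is toℕ j.
  IsSchurPolynomial : Partition n → Polynomial n → Set
  IsSchurPolynomial μ s =
    s * det (λ i j → z i ^ toℕ j)
      ≈ det (λ i j → z i ^ (Vec.lookup (Partition.parts μ) (opposite j) ℕ.+ toℕ j))

  -- f = ∑ g(μ) s(μ), with g of finite support.
  record IsSchurExpansion (s : Partition n → Polynomial n)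
                          (f : Polynomial n) (g : Partition n → ℚ) : Set where
    field
      support         : List (Partition n)
      unique          : Unique support
      vanishesOutside : ∀ μ → μ ∉ support → g μ ≡ 0ℚ
      expansion       : f ≈ ∑ support λ μ → const (g μ) * s μ

{-# OPTIONS --safe #-}
module Submission where

-- Let A = det(zᵢ^(j−1)).  By Vandermonde's formula V² = A², so multiplying the
-- Schur expansion of V^(2k) by A gives A^(2k+1) = ∑ g(μ) det(zᵢ^(μ_(n−j+1)+j−1)).
-- The monomial with the strictly increasing exponents λ_(n−i+1)+i−1 occurs in
-- the summand of λ only, with coefficient 1; hence g(λ) is its coefficient in
-- A^(2k+1), that is, ∑ sign(σ₁⋯σ_(2k+1)) over the tuples of permutations with
-- ∑ⱼ (σⱼ(i)−1) = λ_(n−i+1)+i−1 for all i.  In the hyperdeterminant, replacing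
-- every σⱼ by w₀ ∘ σⱼ ∘ σ₀, where w₀ reverses {1, …, n}, turns the sum over
-- the other permutations into sign(w₀) times this sum for each of the n! choices
-- of σ₀, and sign(w₀) = (−1)^(n(n−1)/2).

open import Algebra.Bundles using (CommutativeRing; RawRing)
import Algebra.Properties.CommutativeMonoid.Sum as MonoidSum
import Algebra.Properties.CommutativeSemigroup as CommutativeSemigroupProperties
import Algebra.Properties.Group as GroupProperties
import Algebra.Properties.Monoid.Sum as MonoidSum⁻
import Algebra.Properties.Ring as RingProperties
import Algebra.Properties.Semiring.Exp as SemiringExp
open import Data.Bool.Base using (Bool; true; false; if_then_else_; _∧_)
import Data.Bool.Properties as Bool
open import Data.Fin.Base using (Fin; zero; suc; toℕ; opposite; punchIn; inject₁; _<_)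
open import Data.Fin.Induction using (<-weakInduction)
open import Data.Fin.Permutation as Perm
  using (Permutation′; _⟨$⟩ʳ_; _⟨$⟩ˡ_; _∘ₚ_; flip; insert; reverse; inverseˡ; inverseʳ)
import Data.Fin.Properties as Fin
open import Data.Integer.Base as ℤ using (ℤ; +_; 0ℤ; 1ℤ; +0; +[1+_]; -[1+_])
import Data.Integer.Properties as ℤ
open import Data.List.Base as List
  using (List; []; _∷_; _++_; cartesianProductWith; allFin; length)
import Data.List.Membership.DecPropositional as DecMembership
open import Data.List.Membership.Propositional using (_∈_; _∉_)
open import Data.List.Membership.Propositional.Properties using (∈-allFin)
import Data.List.Properties as List
open import Data.List.Relation.Unary.All as All using ([]; _∷_)
open import Data.List.Relation.Unary.AllPairs using (AllPairs; []; _∷_)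
open import Data.List.Relation.Unary.Any using (here; there)
open import Data.List.Relation.Unary.Unique.Propositional using (Unique)
import Data.List.Relation.Unary.Unique.Propositional.Properties as Unique
open import Data.Nat.Base as ℕ using (ℕ; zero; suc; s≤s; z≤n; _!; NonZero)
open import Data.Nat.Divisibility using (divides-refl)
import Data.Nat.DivMod as ℕ
import Data.Nat.Properties as ℕ
open import Data.Nat.Tactic.RingSolver using (solve-∀)
open import Data.Product.Base using (_×_; _,_)
open import Data.Rational.Base as ℚ using (ℚ; 0ℚ; 1ℚ; mkℚ; toℚᵘ)
import Data.Rational.Properties as ℚ
open import Data.Rational.Unnormalised.Base as ℚᵘ using (mkℚᵘ; *≡*)
import Data.Rational.Unnormalised.Properties as ℚᵘ
open import Data.Vec.Base as Vec
  using (Vec; []; _∷_; zipWith; tabulate; replicate; lookup)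
open import Data.Vec.Functional as Vector using ()
import Data.Vec.Properties as Vec
import Data.Vec.Relation.Unary.Linked as Linked
import Data.Vec.Relation.Unary.Linked.Properties as Linked
open import Function.Base using (_∘_)
open import Function.Bundles using (Injection; Inverse; mk⇔)
open import Function.Properties.Inverse using (↔⇒↣)
open import Relation.Binary.Definitions using (DecidableEquality; tri<; tri≈; tri>)
open import Relation.Binary.PropositionalEquality as ≡ using (_≡_; _≢_)
import Relation.Binary.Reasoning.Setoid as SetoidReasoning
open import Relation.Binary.Structures using (IsEquivalence)
open import Relation.Nullary.Decidable
  using (Dec; yes; no; does; dec-true; dec-false; does-⇔; map′)
open import Relation.Nullary.Negation using (¬_; contradiction)
open import Defs

-- Division by A is avoided: a Schur polynomial enters only through its product with A, and what
-- remains is a comparison of coefficients. V and A are compared through their squares because each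
-- factor of V is the negative of the corresponding factor in Vandermonde's product.
--
-- The reversal w₀ answers the shape of the delta in `Δ`. It asks λ_(n-σ₀(i)+1) + σ₀(i) + ∑ⱼ σⱼ(i)
-- to equal (2k+1)n + 1, so the σⱼ stand on the same side as the part of λ. Replacing σⱼ(i) by n + 1
-- - σⱼ(σ₀(i)) = n - (σⱼ(σ₀(i)) - 1) cancels the 2k+1 copies of n and moves the sum to the other
-- side, where it is an exponent in A^(2k+1). In the signs, σ₀ then occurs 2k+2 times and
-- disappears, while w₀ occurs 2k+1 times and survives once.
--
-- Permutations are identified when they agree pointwise. Reindexing a sum over `𝔖` therefore needs
-- a bijection of setoids and a summand that respects pointwise equality.

private
  variable
    m n : ℕ
    A B C : Set

-- Decisions, permutations and triangular numbers

if-yes : ∀ {a p} {A : Set a} {P : Set p} (P? : Dec P) {x y : A} → P →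
         (if does P? then x else y) ≡ x
if-yes P? p rewrite dec-true P? p = ≡.refl

if-no : ∀ {a p} {A : Set a} {P : Set p} (P? : Dec P) {x y : A} → ¬ P →
        (if does P? then x else y) ≡ y
if-no P? ¬p rewrite dec-false P? ¬p = ≡.refl

infix 4 _≈?_
_≈?_ : (π ρ : Permutation′ n) → Dec (π Perm.≈ ρ)
π ≈? ρ = Fin.all? λ i → (π ⟨$⟩ʳ i) Fin.≟ (ρ ⟨$⟩ʳ i)

-- Skipping the value j keeps the order of all others, so inserting a value into a permutation
-- preserves the inversions already there.
does-punchIn-<? : ∀ (j : Fin (suc n)) a b →
                  does (punchIn j a Fin.<? punchIn j b) ≡ does (a Fin.<? b)
does-punchIn-<? zero    _       _       = ≡.refl
does-punchIn-<? (suc j) zero    zero    = ≡.refl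
does-punchIn-<? (suc j) zero    (suc b) = ≡.refl
does-punchIn-<? (suc j) (suc a) zero    = ≡.refl
does-punchIn-<? (suc j) (suc a) (suc b) = does-punchIn-<? j a b

permutation-injective : (π : Permutation′ n) → ∀ {i j} → π ⟨$⟩ʳ i ≡ π ⟨$⟩ʳ j → i ≡ j
permutation-injective π = Injection.injective (↔⇒↣ π)

flip-cong : {π ρ : Permutation′ n} → π Perm.≈ ρ → flip π Perm.≈ flip ρ
flip-cong {π = π} {ρ} eq i = permutation-injective ρ
  (≡.trans (≡.sym (eq _)) (≡.trans (inverseʳ π) (≡.sym (inverseʳ ρ))))

opposite-< : ∀ (i j : Fin n) → i < j → opposite j < opposite i
opposite-< i j i<j = ≡.subst₂ ℕ._<_ (≡.sym (Fin.opposite-prop j)) (≡.sym (Fin.opposite-prop i))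
  (ℕ.∸-monoʳ-< (s≤s i<j) (Fin.toℕ<n j))

triangular-suc : ∀ n → suc n ℕ.* n ℕ./ 2 ≡ n ℕ.+ n ℕ.* (n ℕ.∸ 1) ℕ./ 2
triangular-suc n = ≡.trans (≡.cong (ℕ._/ 2) (double n))
  (≡.trans (ℕ.+-distrib-/-∣ˡ (n ℕ.* (n ℕ.∸ 1)) (divides-refl n))
    (≡.cong (ℕ._+ n ℕ.* (n ℕ.∸ 1) ℕ./ 2) (ℕ.m*n/n≡m n 2)))
  where
  double-suc : ∀ m → suc (suc m) ℕ.* suc m ≡ suc m ℕ.* 2 ℕ.+ suc m ℕ.* m
  double-suc = solve-∀

  double : ∀ n → suc n ℕ.* n ≡ n ℕ.* 2 ℕ.+ n ℕ.* (n ℕ.∸ 1)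
  double zero    = ≡.refl
  double (suc m) = double-suc m

-- Used twice: with `swapFirst` on one side to exchange two rows of a matrix, and with σ₀ and
-- `reverse` for the substitution in the hyperdeterminant.
∘ₚ-inverse : Permutation′ n → Permutation′ n → Inverse (permutationSetoid n) (permutationSetoid n)
∘ₚ-inverse τ υ = record
  { to        = λ π → τ ∘ₚ π ∘ₚ υ
  ; from      = λ π → flip τ ∘ₚ π ∘ₚ flip υ
  ; to-cong   = λ eq i → ≡.cong (υ ⟨$⟩ʳ_) (eq _)
  ; from-cong = λ eq i → ≡.cong (υ ⟨$⟩ˡ_) (eq _)
  ; inverse   =
      (λ {π} {ρ} eq i → ≡.trans (≡.cong (υ ⟨$⟩ʳ_) (eq _))
        (≡.trans (inverseʳ υ) (≡.cong (π ⟨$⟩ʳ_) (inverseˡ τ))))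
    , (λ {π} {ρ} eq i → ≡.trans (≡.cong (υ ⟨$⟩ˡ_) (eq _))
        (≡.trans (inverseˡ υ) (≡.cong (π ⟨$⟩ʳ_) (inverseʳ τ))))
  }

-- The transposition of 0 and 1, written with `insert` so that `sign-insert` yields its sign.
swapFirst : Permutation′ (suc (suc n))
swapFirst = insert zero (suc zero) Perm.id

infix 4 _≈ᵛ_
_≈ᵛ_ : Vec (Permutation′ n) m → Vec (Permutation′ n) m → Set
σs ≈ᵛ τs = ∀ j → lookup σs j Perm.≈ lookup τs j

-- Sums, signs and determinants over a commutative ring, for use over ℚ and over ℚ[z₁, ..., zₙ]

module RingTheory {c ℓ} (R : CommutativeRing c ℓ) where
  open CommutativeRing R hiding (zero) renaming (Carrier to K)
  open RingNotation rawRing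
  open SetoidReasoning setoid
  open RingProperties ring using (-‿distribˡ-*; -‿distribʳ-*; -‿involutive; -1*x≈-x)
  open GroupProperties +-group using (⁻¹-anti-homo-//)
  open SemiringExp semiring using (^-congˡ; ^-assocʳ; ^-homo-*)
  open CommutativeSemigroupProperties *-commutativeSemigroup
    using (x∙yz≈y∙xz; interchange)
  open CommutativeSemigroupProperties +-commutativeSemigroup
    using () renaming (interchange to +-interchange)
  open MonoidSum *-commutativeMonoid public using () renaming
    ( sum-cong-≋ to ∏-cong
    ; ∑-distrib-+ to ∏-distrib-*
    ; ∑-comm to ∏-comm
    ; sum-permute to ∏-permute
    ; sum-replicate-zero to ∏-one
    )

  if-cong : ∀ {p} {P : Set p} (P? : Dec P) {x y z : K} {w : K} → (P → x ≈ y) → z ≈ w →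
            (if does P? then x else z) ≈ (if does P? then y else w)
  if-cong (yes p) x≈y z≈w = x≈y p
  if-cong (no ¬p) x≈y z≈w = z≈w

  -- Sums over lists

  ∑-cong : ∀ (xs : List A) {f g : A → K} → (∀ x → f x ≈ g x) → ∑ xs f ≈ ∑ xs g
  ∑-cong []       f≈g = refl
  ∑-cong (x ∷ xs) f≈g = +-cong (f≈g x) (∑-cong xs f≈g)

  ∑-zero : ∀ (xs : List A) {f : A → K} → (∀ x → x ∈ xs → f x ≈ 0#) → ∑ xs f ≈ 0#
  ∑-zero []       f≈0 = refl
  ∑-zero (x ∷ xs) f≈0 =
    trans (+-cong (f≈0 x (here ≡.refl)) (∑-zero xs λ y → f≈0 y ∘ there)) (+-identityˡ 0#)

  ∑-++ : ∀ (xs ys : List A) (f : A → K) → ∑ (xs ++ ys) f ≈ ∑ xs f + ∑ ys f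
  ∑-++ []       ys f = sym (+-identityˡ _)
  ∑-++ (x ∷ xs) ys f = trans (+-congˡ (∑-++ xs ys f)) (sym (+-assoc _ _ _))

  ∑-map : ∀ (h : A → B) xs (f : B → K) → ∑ (List.map h xs) f ≡ ∑ xs (f ∘ h)
  ∑-map h []       f = ≡.refl
  ∑-map h (x ∷ xs) f = ≡.cong (λ s → f (h x) + s) (∑-map h xs f)

  ∑-cartesianProductWith : ∀ (op : A → B → C) xs ys (f : C → K) →
    ∑ (cartesianProductWith op xs ys) f ≈ ∑ xs λ x → ∑ ys λ y → f (op x y)
  ∑-cartesianProductWith op []       ys f = refl
  ∑-cartesianProductWith op (x ∷ xs) ys f = begin
    ∑ (List.map (op x) ys ++ cartesianProductWith op xs ys) f
      ≈⟨ ∑-++ (List.map (op x) ys) _ f ⟩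
    ∑ (List.map (op x) ys) f + ∑ (cartesianProductWith op xs ys) f
      ≈⟨ +-cong (reflexive (∑-map (op x) ys f)) (∑-cartesianProductWith op xs ys f) ⟩
    (∑ ys λ y → f (op x y)) + (∑ xs λ x → ∑ ys λ y → f (op x y)) ∎

  ∑-distrib-+ : ∀ (xs : List A) (f g : A → K) → (∑ xs λ x → f x + g x) ≈ ∑ xs f + ∑ xs g
  ∑-distrib-+ []       f g = sym (+-identityˡ 0#)
  ∑-distrib-+ (x ∷ xs) f g = trans (+-congˡ (∑-distrib-+ xs f g)) (+-interchange _ _ _ _)

  *-distribˡ-∑ : ∀ (xs : List A) y (f : A → K) → y * ∑ xs f ≈ ∑ xs λ x → y * f x
  *-distribˡ-∑ []       y f = zeroʳ y
  *-distribˡ-∑ (x ∷ xs) y f = trans (distribˡ y _ _) (+-congˡ (*-distribˡ-∑ xs y f))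

  *-distribʳ-∑ : ∀ (xs : List A) y (f : A → K) → ∑ xs f * y ≈ ∑ xs λ x → f x * y
  *-distribʳ-∑ xs y f = begin
    ∑ xs f * y          ≈⟨ *-comm _ _ ⟩
    y * ∑ xs f          ≈⟨ *-distribˡ-∑ xs y f ⟩
    (∑ xs λ x → y * f x) ≈⟨ ∑-cong xs (λ x → *-comm _ _) ⟩
    (∑ xs λ x → f x * y) ∎

  ∑-comm : ∀ (xs : List A) (ys : List B) (f : A → B → K) →
           (∑ xs λ x → ∑ ys λ y → f x y) ≈ ∑ ys λ y → ∑ xs λ x → f x y
  ∑-comm []       ys f = sym (∑-zero ys λ _ _ → refl)
  ∑-comm (x ∷ xs) ys f = trans (+-congˡ (∑-comm xs ys f)) (sym (∑-distrib-+ ys _ _))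

  -- The relation is a parameter because permutations are distinct up to pointwise equality, whereas
  -- column indices and partitions are distinct up to ≡.
  ∑-single : ∀ {r} {_~_ : A → A → Set r} → (∀ {x y} → x ~ y → y ~ x) →
             ∀ {xs} → AllPairs (λ x y → ¬ x ~ y) xs → ∀ {y} → y ∈ xs →
             (f : A → K) → (∀ x → ¬ y ~ x → f x ≈ 0#) → ∑ xs f ≈ f y
  ∑-single ~-sym {xs = y ∷ xs} (y≁ ∷ _) (here ≡.refl) f f≈0 = trans
    (+-congˡ (∑-zero xs λ x x∈ → f≈0 x (All.lookup y≁ x∈))) (+-identityʳ _)
  ∑-single ~-sym (x≁ ∷ xs≁) (there y∈) f f≈0 = trans
    (+-cong (f≈0 _ λ y~x → All.lookup x≁ y∈ (~-sym y~x)) (∑-single ~-sym xs≁ y∈ f f≈0))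
    (+-identityˡ _)

  Respects≈ : (Permutation′ n → K) → Set ℓ
  Respects≈ F = ∀ {π ρ} → π Perm.≈ ρ → F π ≈ F ρ

  -- The list is only known to contain some ρ pointwise equal to π, so F has to take the same value
  -- on both.
  ∑-𝔖-single : ∀ (F : Permutation′ n → K) → Respects≈ F → ∀ π →
               (∀ ρ → ¬ π Perm.≈ ρ → F ρ ≈ 0#) → ∑ (𝔖 n) F ≈ F π
  ∑-𝔖-single {n} F F-resp π F≈0 =
    let ρ , ρ∈ , ρ≈π = 𝔖-complete π
    in trans
      (∑-single {_~_ = Perm._≈_} (λ eq i → ≡.sym (eq i)) (𝔖-unique n) ρ∈ F
        (λ τ ρ≉τ → F≈0 τ λ π≈τ → ρ≉τ λ i → ≡.trans (ρ≈π i) (π≈τ i)))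
      (F-resp ρ≈π)

  -- Double counting: the matrix `E`, supported on the graph of φ, has row sums F (φ π) and column
  -- sums F ρ. This needs no rearrangement of the list itself.
  ∑-𝔖-reindex : ∀ (φ : Inverse (permutationSetoid n) (permutationSetoid n)) →
                (F : Permutation′ n → K) → Respects≈ F →
                ∑ (𝔖 n) (F ∘ Inverse.to φ) ≈ ∑ (𝔖 n) F
  ∑-𝔖-reindex {n} φ F F-resp = begin
    (∑ (𝔖 n) λ π → F (to π))                ≈⟨ ∑-cong (𝔖 n) (λ π → sym (row π)) ⟩
    (∑ (𝔖 n) λ π → ∑ (𝔖 n) λ ρ → E π ρ)     ≈⟨ ∑-comm (𝔖 n) (𝔖 n) E ⟩
    (∑ (𝔖 n) λ ρ → ∑ (𝔖 n) λ π → E π ρ)     ≈⟨ ∑-cong (𝔖 n) column ⟩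
    ∑ (𝔖 n) F                               ∎
    where
    open Inverse φ using (to; from; to-cong; from-cong)
    E : Permutation′ n → Permutation′ n → K
    E π ρ = if does (to π ≈? ρ) then F ρ else 0#

    E-hit : ∀ π ρ → to π Perm.≈ ρ → E π ρ ≈ F ρ
    E-hit π ρ eq = reflexive (if-yes (to π ≈? ρ) eq)

    E-miss : ∀ π ρ → ¬ to π Perm.≈ ρ → E π ρ ≈ 0#
    E-miss π ρ neq = reflexive (if-no (to π ≈? ρ) neq)

    E-cong : ∀ {π π′ ρ ρ′} → π Perm.≈ π′ → ρ Perm.≈ ρ′ → E π ρ ≈ E π′ ρ′
    E-cong {π} {π′} {ρ} {ρ′} π≈ ρ≈ with to π ≈? ρ
    ... | yes eq = trans (E-hit π ρ eq) (trans (F-resp ρ≈) (sym (E-hit π′ ρ′ λ i →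
            ≡.trans (≡.sym (to-cong π≈ i)) (≡.trans (eq i) (ρ≈ i)))))
    ... | no neq = trans (E-miss π ρ neq) (sym (E-miss π′ ρ′ λ eq → neq λ i →
            ≡.trans (to-cong π≈ i) (≡.trans (eq i) (≡.sym (ρ≈ i)))))

    row : ∀ π → ∑ (𝔖 n) (E π) ≈ F (to π)
    row π = trans
      (∑-𝔖-single (E π) (λ {ρ} {ρ′} → E-cong {π} {π} {ρ} {ρ′} (λ _ → ≡.refl)) (to π) (E-miss π))
      (E-hit π (to π) λ _ → ≡.refl)

    column : ∀ ρ → (∑ (𝔖 n) λ π → E π ρ) ≈ F ρ
    column ρ = trans
      (∑-𝔖-single (λ π → E π ρ) (λ {π} {π′} eq → E-cong {π} {π′} {ρ} {ρ} eq λ _ → ≡.refl) (from ρ)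
        λ π from≉ → E-miss π ρ λ eq → from≉ λ i →
          Inverse.inverseʳ φ {x = π} {y = ρ} (λ j → ≡.sym (eq j)) i)
      (E-hit (from ρ) ρ (Inverse.strictlyInverseˡ φ ρ))

  -- Products over pairs

  ∏<-cong : ∀ {f g : Fin n → Fin n → K} → (∀ i j → i < j → f i j ≈ g i j) → ∏< f ≈ ∏< g
  ∏<-cong {f = f} {g} f≈g = ∏-cong λ i → ∏-cong λ j → entry i j
    where
    entry : ∀ i j → (if does (i Fin.<? j) then f i j else 1#) ≈ (if does (i Fin.<? j) then g i j else 1#)
    entry i j = if-cong (i Fin.<? j) (f≈g i j) refl

  ∏<-distrib-* : ∀ (f g : Fin n → Fin n → K) → (∏< λ i j → f i j * g i j) ≈ ∏< f * ∏< g
  ∏<-distrib-* f g = trans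
    (∏-cong λ i → trans (∏-cong (entry i)) (∏-distrib-* {_} (λ j → if does (i Fin.<? j) then f i j else 1#) _))
    (∏-distrib-* (λ i → ∏ λ j → if does (i Fin.<? j) then f i j else 1#) _)
    where
    entry : ∀ i j → (if does (i Fin.<? j) then f i j * g i j else 1#) ≈
      (if does (i Fin.<? j) then f i j else 1#) * (if does (i Fin.<? j) then g i j else 1#)
    entry i j with does (i Fin.<? j)
    ... | true  = refl
    ... | false = sym (*-identityˡ 1#)

  ∏<-one : ∀ {f : Fin n → Fin n → K} → (∀ i j → i < j → f i j ≈ 1#) → ∏< f ≈ 1#
  ∏<-one {n} {f} f≈1 = trans (∏<-cong f≈1)
    (trans (∏-cong λ i → trans (∏-cong λ j → entry i j) (∏-one n)) (∏-one n))
    where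
    entry : ∀ (i j : Fin n) → (if does (i Fin.<? j) then 1# else 1#) ≈ 1#
    entry i j with does (i Fin.<? j)
    ... | true  = refl
    ... | false = refl

  -- An off-diagonal factor lies in exactly one of the triangles i < j and j < i; transposing the
  -- second folds it onto the first.
  ∏-pairs : ∀ (G : Fin n → Fin n → K) → (∀ i → G i i ≈ 1#) →
            (∏ λ i → ∏ λ j → G i j) ≈ ∏< λ i j → G i j * G j i
  ∏-pairs G G≈1 = begin
    (∏ λ i → ∏ λ j → G i j)
      ≈⟨ ∏-cong (λ i → trans (∏-cong (split i)) (∏-distrib-* (λ j → L i j) (λ j → U j i))) ⟩
    (∏ λ i → (∏ λ j → L i j) * (∏ λ j → U j i))
      ≈⟨ ∏-distrib-* (λ i → ∏ (L i)) _ ⟩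
    ∏< G * (∏ λ i → ∏ λ j → U j i)
      ≈⟨ *-congˡ (∏-comm (λ i j → U j i)) ⟩
    ∏< G * (∏< λ j i → G i j)
      ≈⟨ ∏<-distrib-* G (λ i j → G j i) ⟨
    (∏< λ i j → G i j * G j i) ∎
    where
    L U : Fin _ → Fin _ → K
    L i j = if does (i Fin.<? j) then G i j else 1#
    U j i = if does (j Fin.<? i) then G i j else 1#

    split : ∀ i j → G i j ≈ L i j * U j i
    split i j with Fin.<-cmp i j
    ... | tri< i<j _ j≮i    = sym (trans
      (*-cong (reflexive (if-yes (i Fin.<? j) i<j)) (reflexive (if-no (j Fin.<? i) j≮i)))
      (*-identityʳ _))
    ... | tri≈ i≮i ≡.refl _ = trans (G≈1 i) (sym (trans
      (*-cong (reflexive (if-no (i Fin.<? i) i≮i)) (reflexive (if-no (i Fin.<? i) i≮i)))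
      (*-identityˡ _)))
    ... | tri> i≮j _ j<i    = sym (trans
      (*-cong (reflexive (if-no (i Fin.<? j) i≮j)) (reflexive (if-yes (j Fin.<? i) j<i)))
      (*-identityˡ _))

  -- π permutes the unordered pairs. `G` keeps S a b when the preimages of a and b are in increasing
  -- order, so pulling back along π gives the left product, and of `G a b` and `G b a` exactly one
  -- is kept.
  ∏<-permute : ∀ (S : Fin n → Fin n → K) → (∀ i j → i ≢ j → S i j ≈ S j i) →
               (π : Permutation′ n) → (∏< λ i j → S (π ⟨$⟩ʳ i) (π ⟨$⟩ʳ j)) ≈ ∏< S
  ∏<-permute S S-sym π = begin
    (∏< λ i j → S (π ⟨$⟩ʳ i) (π ⟨$⟩ʳ j))
      ≈⟨ ∏-cong (λ i → ∏-cong λ j → pull i j) ⟩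
    (∏ λ i → ∏ λ j → G (π ⟨$⟩ʳ i) (π ⟨$⟩ʳ j))
      ≈⟨ ∏-cong (λ i → ∏-permute (G (π ⟨$⟩ʳ i)) π) ⟨
    (∏ λ i → ∏ λ b → G (π ⟨$⟩ʳ i) b)
      ≈⟨ ∏-permute (λ a → ∏ (G a)) π ⟨
    (∏ λ a → ∏ λ b → G a b)
      ≈⟨ ∏-pairs G G-diagonal ⟩
    (∏< λ a b → G a b * G b a)
      ≈⟨ ∏<-cong pair ⟩
    ∏< S ∎
    where
    G : Fin _ → Fin _ → K
    G a b = if does ((π ⟨$⟩ˡ a) Fin.<? (π ⟨$⟩ˡ b)) then S a b else 1#

    pull : ∀ i j → (if does (i Fin.<? j) then S (π ⟨$⟩ʳ i) (π ⟨$⟩ʳ j) else 1#) ≈ G (π ⟨$⟩ʳ i) (π ⟨$⟩ʳ j)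
    pull i j = reflexive (≡.sym (≡.cong₂
      (λ a b → if does (a Fin.<? b) then S (π ⟨$⟩ʳ i) (π ⟨$⟩ʳ j) else 1#) (inverseˡ π) (inverseˡ π)))

    G-diagonal : ∀ a → G a a ≈ 1#
    G-diagonal a = reflexive (if-no ((π ⟨$⟩ˡ a) Fin.<? (π ⟨$⟩ˡ a)) (ℕ.<-irrefl ≡.refl))

    pair : ∀ a b → a < b → G a b * G b a ≈ S a b
    pair a b a<b with Fin.<-cmp (π ⟨$⟩ˡ a) (π ⟨$⟩ˡ b)
    ... | tri< p _ ¬q = trans
      (*-cong (reflexive (if-yes ((π ⟨$⟩ˡ a) Fin.<? (π ⟨$⟩ˡ b)) p))
              (reflexive (if-no ((π ⟨$⟩ˡ b) Fin.<? (π ⟨$⟩ˡ a)) ¬q)))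
      (*-identityʳ _)
    ... | tri≈ _ eq _ =
      contradiction a<b (ℕ.<-irrefl (≡.cong toℕ (permutation-injective (flip π) eq)))
    ... | tri> ¬p _ q = trans
      (*-cong (reflexive (if-no ((π ⟨$⟩ˡ a) Fin.<? (π ⟨$⟩ˡ b)) ¬p))
              (reflexive (if-yes ((π ⟨$⟩ˡ b) Fin.<? (π ⟨$⟩ˡ a)) q)))
      (trans (*-identityˡ _) (sym (S-sym a b λ { ≡.refl → ℕ.<-irrefl ≡.refl a<b })))

  -- Signs

  -1*-1≈1 : - 1# * - 1# ≈ 1#
  -1*-1≈1 = trans (-1*x≈-x (- 1#)) (-‿involutive 1#)

  -- `sign π` unfolds to the product of ε (π i) (π j) over i < j.
  ε : Fin n → Fin n → K
  ε a b = if does (b Fin.<? a) then - 1# else 1#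

  ε-square : ∀ (a b : Fin n) → ε a b * ε a b ≈ 1#
  ε-square a b with does (b Fin.<? a)
  ... | true  = -1*-1≈1
  ... | false = *-identityˡ 1#

  ε-< : ∀ {a b : Fin n} → a < b → ε a b ≈ 1#
  ε-< {a = a} {b} a<b = reflexive (if-no (b Fin.<? a) (ℕ.<⇒≯ a<b))

  ε-swap : ∀ {a b : Fin n} → a ≢ b → ε b a ≈ - 1# * ε a b
  ε-swap {a = a} {b} a≢b with Fin.<-cmp a b
  ... | tri< p _ _  = trans (reflexive (if-yes (a Fin.<? b) p))
                            (sym (trans (*-congˡ (ε-< p)) (*-identityʳ _)))
  ... | tri≈ _ eq _ = contradiction eq a≢b
  ... | tri> _ _ q  = trans (ε-< q)
                            (sym (trans (*-congˡ (reflexive (if-yes (b Fin.<? a) q))) -1*-1≈1))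

  sign-cong : {π ρ : Permutation′ n} → π Perm.≈ ρ → sign π ≈ sign ρ
  sign-cong eq = ∏<-cong λ i j _ → reflexive (≡.cong₂ ε (eq i) (eq j))

  sign-square : (π : Permutation′ n) → sign π * sign π ≈ 1#
  sign-square π = trans (sym (∏<-distrib-* (λ i j → ε (π ⟨$⟩ʳ i) (π ⟨$⟩ʳ j)) _))
    (∏<-one λ i j _ → ε-square (π ⟨$⟩ʳ i) (π ⟨$⟩ʳ j))

  sign-id : sign {n} Perm.id ≈ 1#
  sign-id {n} = ∏<-one {n} {ε} λ _ _ → ε-<

  -- S a b records whether ρ reverses the unordered pair {a , b}.
  sign-∘ : (π ρ : Permutation′ n) → sign (π ∘ₚ ρ) ≈ sign π * sign ρ
  sign-∘ π ρ = begin
    sign (π ∘ₚ ρ)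
      ≈⟨ ∏<-cong (λ i j _ → split (π ⟨$⟩ʳ i) (π ⟨$⟩ʳ j)) ⟩
    (∏< λ i j → ε (π ⟨$⟩ʳ i) (π ⟨$⟩ʳ j) * S (π ⟨$⟩ʳ i) (π ⟨$⟩ʳ j))
      ≈⟨ ∏<-distrib-* (λ i j → ε (π ⟨$⟩ʳ i) (π ⟨$⟩ʳ j)) _ ⟩
    sign π * (∏< λ i j → S (π ⟨$⟩ʳ i) (π ⟨$⟩ʳ j))
      ≈⟨ *-congˡ (∏<-permute S S-sym π) ⟩
    sign π * ∏< S
      ≈⟨ *-congˡ (∏<-cong {f = S} λ i j i<j → trans (*-congʳ (ε-< i<j)) (*-identityˡ _)) ⟩
    sign π * sign ρ ∎
    where
    S : Fin _ → Fin _ → K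
    S a b = ε a b * ε (ρ ⟨$⟩ʳ a) (ρ ⟨$⟩ʳ b)

    split : ∀ a b → ε (ρ ⟨$⟩ʳ a) (ρ ⟨$⟩ʳ b) ≈ ε a b * S a b
    split a b = sym (begin
      ε a b * (ε a b * ε (ρ ⟨$⟩ʳ a) (ρ ⟨$⟩ʳ b)) ≈⟨ *-assoc _ _ _ ⟨
      (ε a b * ε a b) * ε (ρ ⟨$⟩ʳ a) (ρ ⟨$⟩ʳ b) ≈⟨ *-congʳ (ε-square a b) ⟩
      1# * ε (ρ ⟨$⟩ʳ a) (ρ ⟨$⟩ʳ b)              ≈⟨ *-identityˡ _ ⟩
      ε (ρ ⟨$⟩ʳ a) (ρ ⟨$⟩ʳ b)                   ∎)

    S-sym : ∀ a b → a ≢ b → S a b ≈ S b a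
    S-sym a b a≢b = sym (begin
      ε b a * ε (ρ ⟨$⟩ʳ b) (ρ ⟨$⟩ʳ a)
        ≈⟨ *-cong (ε-swap a≢b) (ε-swap (a≢b ∘ permutation-injective ρ)) ⟩
      (- 1# * ε a b) * (- 1# * ε (ρ ⟨$⟩ʳ a) (ρ ⟨$⟩ʳ b))
        ≈⟨ interchange _ _ _ _ ⟩
      (- 1# * - 1#) * S a b
        ≈⟨ *-congʳ -1*-1≈1 ⟩
      1# * S a b
        ≈⟨ *-identityˡ _ ⟩
      S a b ∎)

  sign-flip : (π : Permutation′ n) → sign (flip π) ≈ sign π
  sign-flip {n} π = begin
    sign (flip π)                        ≈⟨ *-identityˡ _ ⟨
    1# * sign (flip π)                   ≈⟨ *-congʳ (sign-square π) ⟨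
    (sign π * sign π) * sign (flip π)    ≈⟨ *-assoc _ _ _ ⟩
    sign π * (sign π * sign (flip π))    ≈⟨ *-congˡ (sign-∘ π (flip π)) ⟨
    sign π * sign (π ∘ₚ flip π)          ≈⟨ *-congˡ (sign-cong {π = π ∘ₚ flip π} {Perm.id} λ i → inverseˡ π) ⟩
    sign π * sign {n} Perm.id            ≈⟨ *-congˡ (sign-id {n}) ⟩
    sign π * 1#                          ≈⟨ *-identityʳ _ ⟩
    sign π                               ∎

  -- headSign j is (−1)^j.
  headSign : Fin (suc n) → K
  headSign j = ∏ λ k → ε j (punchIn j k)

  headSign-zero : headSign {n} zero ≈ 1#
  headSign-zero {n} = ∏-one n

  headSign-one : headSign {suc n} (suc zero) ≈ - 1#
  headSign-one {n} = trans (*-congˡ (∏-one n)) (*-identityʳ _)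

  -- Pairs containing 0 compare j with every other value, and π only changes the order of these
  -- factors. The remaining pairs compare values under `punchIn j`, which keeps the inversions of π.
  sign-insert : ∀ (j : Fin (suc n)) (π : Permutation′ n) →
                sign (insert zero j π) ≈ headSign j * sign π
  sign-insert j π = *-cong
    (trans (*-identityˡ _) (sym (∏-permute (λ k → ε j (punchIn j k)) π)))
    (∏-cong λ i → trans (*-identityˡ _) (∏-cong λ k → reflexive (≡.cong
      (λ b → if does (i Fin.<? k) then (if b then - 1# else 1#) else 1#)
      (does-punchIn-<? j (π ⟨$⟩ʳ k) (π ⟨$⟩ʳ i)))))

  -- Multilinear and alternating functions of the rows

  Congruent : ((Fin n → Fin m → K) → K) → Set _
  Congruent D = ∀ {M N} → (∀ i j → M i j ≈ N i j) → D M ≈ D N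

  -- Additivity and homogeneity in row i at once, stated for three matrices that agree elsewhere
  -- instead of through an operation replacing a row.
  Multilinear : ((Fin n → Fin m → K) → K) → Set _
  Multilinear D = ∀ i x {L M N} → (∀ j → L i j ≈ M i j + x * N i j) →
    (∀ k → k ≢ i → ∀ j → L k j ≈ M k j) → (∀ k → k ≢ i → ∀ j → L k j ≈ N k j) →
    D L ≈ D M + x * D N

  -- It is enough to ask this for consecutive rows.
  Alternating : ((Fin n → Fin m → K) → K) → Set _
  Alternating D = ∀ i i′ → toℕ i′ ≡ suc (toℕ i) → ∀ {M} → (∀ j → M i j ≈ M i′ j) → D M ≈ 0#

  -- All rows change simultaneously, each receiving a multiple of the original row above it. With x
  -- = -x₀ this is the classical reduction of the Vandermonde matrix, here on its transpose.
  addPrevious : K → (Fin (suc n) → Fin m → K) → Fin (suc n) → Fin m → K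
  addPrevious x r zero    j = r zero j
  addPrevious x r (suc i) j = r (suc i) j + x * r (inject₁ i) j

  ∷-cong : ∀ {u : Fin m → K} {M N : Fin n → Fin m → K} → (∀ i j → M i j ≈ N i j) →
           ∀ i j → (u Vector.∷ M) i j ≈ (u Vector.∷ N) i j
  ∷-cong M≈N zero    j = refl
  ∷-cong M≈N (suc i) j = M≈N i j

  alternating-addPrevious : ∀ (D : (Fin (suc n) → Fin m → K) → K) →
    Congruent D → Multilinear D → Alternating D →
    ∀ x r → D (addPrevious x r) ≈ D r
  alternating-addPrevious {n = zero} D D-cong D-linear D-alt x r = D-cong λ { zero j → refl }
  alternating-addPrevious {n = suc n} D D-cong D-linear D-alt x r = begin
    D (addPrevious x r)
      ≈⟨ D-linear (suc zero) x {M = r zero Vector.∷ addPrevious x (r ∘ suc)}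
           {N = r zero Vector.∷ (r zero Vector.∷ (addPrevious x (r ∘ suc) ∘ suc))}
           (λ j → refl)
           (λ { zero _ j → refl ; (suc zero) ≢ j → contradiction ≡.refl ≢ ; (suc (suc k)) _ j → refl })
           (λ { zero _ j → refl ; (suc zero) ≢ j → contradiction ≡.refl ≢ ; (suc (suc k)) _ j → refl }) ⟩
    D′ (addPrevious x (r ∘ suc)) + x * D′ (r zero Vector.∷ (addPrevious x (r ∘ suc) ∘ suc))
      ≈⟨ +-congˡ (trans (*-congˡ (D-alt zero (suc zero) ≡.refl λ j → refl)) (zeroʳ x)) ⟩
    D′ (addPrevious x (r ∘ suc)) + 0#
      ≈⟨ +-identityʳ _ ⟩
    D′ (addPrevious x (r ∘ suc))
      ≈⟨ alternating-addPrevious D′ (D-cong ∘ ∷-cong)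
           (λ i y L≈ L≈M L≈N → D-linear (suc i) y L≈ (away i L≈M) (away i L≈N))
           (λ i i′ eq M≈ → D-alt (suc i) (suc i′) (≡.cong suc eq) M≈) x (r ∘ suc) ⟩
    D′ (r ∘ suc)
      ≈⟨ D-cong (λ { zero j → refl ; (suc i) j → refl }) ⟩
    D r ∎
    where
    D′ : (Fin (suc n) → Fin _ → K) → K
    D′ M = D (r zero Vector.∷ M)

    away : ∀ i {L M : Fin (suc n) → Fin _ → K} → (∀ k → k ≢ i → ∀ j → L k j ≈ M k j) →
           ∀ k → k ≢ suc i → ∀ j → (r zero Vector.∷ L) k j ≈ (r zero Vector.∷ M) k j
    away i L≈M zero    _   j = refl
    away i L≈M (suc k) k≢i j = L≈M k (k≢i ∘ ≡.cong suc) j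

  -- Determinants

  det-term : (Fin n → Fin n → K) → Permutation′ n → K
  det-term M π = sign π * ∏ λ i → M i (π ⟨$⟩ʳ i)

  det-term-resp : ∀ (M : Fin n → Fin n → K) → Respects≈ (det-term M)
  det-term-resp M {π} {ρ} eq =
    *-cong (sign-cong {π = π} {ρ} eq) (∏-cong λ i → reflexive (≡.cong (M i) (eq i)))

  det-cong : Congruent (det {n})
  det-cong {n} M≈N = ∑-cong (𝔖 n) λ π → *-congˡ (∏-cong λ i → M≈N i _)

  ∏-linear : ∀ (i : Fin n) x {f g h : Fin n → K} → f i ≈ g i + x * h i →
             (∀ k → k ≢ i → f k ≈ g k) → (∀ k → k ≢ i → f k ≈ h k) →
             ∏ f ≈ ∏ g + x * ∏ h
  ∏-linear zero x {f} {g} {h} fi f≈g f≈h = begin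
    f zero * ∏ (f ∘ suc)
      ≈⟨ *-congʳ fi ⟩
    (g zero + x * h zero) * ∏ (f ∘ suc)
      ≈⟨ distribʳ _ _ _ ⟩
    g zero * ∏ (f ∘ suc) + (x * h zero) * ∏ (f ∘ suc)
      ≈⟨ +-cong (*-congˡ (∏-cong λ k → f≈g (suc k) λ ()))
                (trans (*-assoc _ _ _) (*-congˡ (*-congˡ (∏-cong λ k → f≈h (suc k) λ ())))) ⟩
    g zero * ∏ (g ∘ suc) + x * (h zero * ∏ (h ∘ suc)) ∎
  ∏-linear (suc i) x {f} {g} {h} fi f≈g f≈h = begin
    f zero * ∏ (f ∘ suc)
      ≈⟨ *-congˡ (∏-linear i x fi (λ k k≢i → f≈g (suc k) (k≢i ∘ Fin.suc-injective))
                                  (λ k k≢i → f≈h (suc k) (k≢i ∘ Fin.suc-injective))) ⟩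
    f zero * (∏ (g ∘ suc) + x * ∏ (h ∘ suc))
      ≈⟨ distribˡ _ _ _ ⟩
    f zero * ∏ (g ∘ suc) + f zero * (x * ∏ (h ∘ suc))
      ≈⟨ +-cong (*-congʳ (f≈g zero λ ()))
                (trans (x∙yz≈y∙xz _ _ _) (*-congˡ (*-congʳ (f≈h zero λ ())))) ⟩
    g zero * ∏ (g ∘ suc) + x * (h zero * ∏ (h ∘ suc)) ∎

  det-linear : Multilinear (det {n})
  det-linear {n} i x {L} {M} {N} Li L≈M L≈N = begin
    ∑ (𝔖 n) (det-term L)
      ≈⟨ ∑-cong (𝔖 n) term ⟩
    (∑ (𝔖 n) λ π → det-term M π + x * det-term N π)
      ≈⟨ ∑-distrib-+ (𝔖 n) (det-term M) _ ⟩
    det M + (∑ (𝔖 n) λ π → x * det-term N π)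
      ≈⟨ +-congˡ (*-distribˡ-∑ (𝔖 n) x (det-term N)) ⟨
    det M + x * det N ∎
    where
    term : ∀ π → det-term L π ≈ det-term M π + x * det-term N π
    term π = begin
      sign π * (∏ λ k → L k (π ⟨$⟩ʳ k))
        ≈⟨ *-congˡ (∏-linear i x (Li _) (λ k k≢i → L≈M k k≢i _) (λ k k≢i → L≈N k k≢i _)) ⟩
      sign π * ((∏ λ k → M k (π ⟨$⟩ʳ k)) + x * (∏ λ k → N k (π ⟨$⟩ʳ k)))
        ≈⟨ distribˡ _ _ _ ⟩
      sign π * (∏ λ k → M k (π ⟨$⟩ʳ k)) + sign π * (x * (∏ λ k → N k (π ⟨$⟩ʳ k)))
        ≈⟨ +-congˡ (x∙yz≈y∙xz _ _ _) ⟩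
      det-term M π + x * det-term N π ∎

  det-scale : ∀ (y : Fin n → K) (M : Fin n → Fin n → K) →
              det (λ i j → y i * M i j) ≈ ∏ y * det M
  det-scale {n} y M = begin
    det (λ i j → y i * M i j)
      ≈⟨ ∑-cong (𝔖 n) (λ π → trans (*-congˡ (∏-distrib-* y _)) (x∙yz≈y∙xz _ _ _)) ⟩
    (∑ (𝔖 n) λ π → ∏ y * det-term M π)
      ≈⟨ *-distribˡ-∑ (𝔖 n) (∏ y) (det-term M) ⟨
    ∏ y * det M ∎

  det-transpose : ∀ (M : Fin n → Fin n → K) → det (λ i j → M j i) ≈ det M
  det-transpose {n} M = begin
    (∑ (𝔖 n) λ π → sign π * ∏ λ i → M (π ⟨$⟩ʳ i) i)
      ≈⟨ ∑-cong (𝔖 n) (λ π → *-cong (sym (sign-flip π)) (trans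
           (∏-permute (λ i → M (π ⟨$⟩ʳ i) i) (flip π))
           (∏-cong λ i → reflexive (≡.cong (λ k → M k (π ⟨$⟩ˡ i)) (inverseʳ π))))) ⟩
    (∑ (𝔖 n) λ π → det-term M (flip π))
      ≈⟨ ∑-𝔖-reindex flipping (det-term M) (λ {π} {ρ} → det-term-resp M {π} {ρ}) ⟩
    det M ∎
    where
    flipping : Inverse (permutationSetoid n) (permutationSetoid n)
    flipping = record
      { to        = flip
      ; from      = flip
      ; to-cong   = λ {π} {ρ} → flip-cong {π = π} {ρ}
      ; from-cong = λ {π} {ρ} → flip-cong {π = π} {ρ}
      ; inverse   = (λ {π} {ρ} → flip-cong {π = ρ} {flip π})
                  , (λ {π} {ρ} → flip-cong {π = ρ} {flip π})
      }

  minor : (Fin (suc n) → Fin (suc n) → K) → Fin (suc n) → Fin n → Fin n → K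
  minor M j i k = M (suc i) (punchIn j k)

  -- `𝔖 (suc n)` enumerates permutations by their value at 0, so the defining sum is already grouped
  -- along the first row.
  det-laplace : ∀ (M : Fin (suc n) → Fin (suc n) → K) →
    det M ≈ ∑ (allFin (suc n)) λ j → M zero j * (headSign j * det (minor M j))
  det-laplace {n} M = begin
    det M
      ≈⟨ ∑-cartesianProductWith (insert zero) (allFin (suc n)) (𝔖 n) (det-term M) ⟩
    (∑ (allFin (suc n)) λ j → ∑ (𝔖 n) λ π → det-term M (insert zero j π))
      ≈⟨ ∑-cong (allFin (suc n)) (λ j → trans (∑-cong (𝔖 n) (term j))
           (trans (sym (*-distribˡ-∑ (𝔖 n) _ (λ π → headSign j * det-term (minor M j) π)))
                  (*-congˡ (sym (*-distribˡ-∑ (𝔖 n) _ (det-term (minor M j))))))) ⟩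
    (∑ (allFin (suc n)) λ j → M zero j * (headSign j * det (minor M j))) ∎
    where
    term : ∀ j π → det-term M (insert zero j π) ≈ M zero j * (headSign j * det-term (minor M j) π)
    term j π = begin
      sign (insert zero j π) * (M zero j * ∏ λ i → minor M j i (π ⟨$⟩ʳ i))
        ≈⟨ x∙yz≈y∙xz _ _ _ ⟩
      M zero j * (sign (insert zero j π) * ∏ λ i → minor M j i (π ⟨$⟩ʳ i))
        ≈⟨ *-congˡ (trans (*-congʳ (sign-insert j π)) (*-assoc _ _ _)) ⟩
      M zero j * (headSign j * det-term (minor M j) π) ∎

  sign-swapFirst : sign {suc (suc n)} swapFirst ≈ - 1#
  sign-swapFirst {n} = trans (sign-insert {suc n} (suc zero) Perm.id)
    (trans (*-cong (headSign-one {n}) (sign-id {suc n})) (*-identityʳ _))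

  -- Exchanging equal rows shows det M = - det M. Concluding det M = 0 takes the absence of
  -- 2-torsion, which polynomials inherit from ℚ coefficientwise.
  module _ (x≈-x⇒x≈0 : ∀ {x} → x ≈ - x → x ≈ 0#) where

    -- Precomposing with the transposition negates every sign and leaves the products unchanged, as
    -- the first two rows agree.
    det-swapFirst : ∀ {M : Fin (suc (suc n)) → Fin (suc (suc n)) → K} →
                    (∀ j → M zero j ≈ M (suc zero) j) → det M ≈ 0#
    det-swapFirst {n} {M} M₀≈M₁ = x≈-x⇒x≈0 (begin
      det M
        ≈⟨ ∑-𝔖-reindex (∘ₚ-inverse swapFirst Perm.id) (det-term M) (λ {π} {ρ} → det-term-resp M {π} {ρ}) ⟨
      (∑ (𝔖 _) λ π → det-term M (swapFirst ∘ₚ π ∘ₚ Perm.id))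
        ≈⟨ ∑-cong (𝔖 _) term ⟩
      (∑ (𝔖 _) λ π → - 1# * det-term M π)
        ≈⟨ *-distribˡ-∑ (𝔖 _) (- 1#) (det-term M) ⟨
      - 1# * det M
        ≈⟨ -1*x≈-x (det M) ⟩
      - det M ∎)
      where
      M∘swap : ∀ i j → M i j ≈ M (swapFirst ⟨$⟩ʳ i) j
      M∘swap zero          j = M₀≈M₁ j
      M∘swap (suc zero)    j = sym (M₀≈M₁ j)
      M∘swap (suc (suc i)) j = refl

      term : ∀ π → det-term M (swapFirst ∘ₚ π ∘ₚ Perm.id) ≈ - 1# * det-term M π
      term π = begin
        sign (swapFirst ∘ₚ π ∘ₚ Perm.id) * (∏ λ i → M i (π ⟨$⟩ʳ (swapFirst ⟨$⟩ʳ i)))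
          ≈⟨ *-cong (trans (sign-∘ swapFirst (π ∘ₚ Perm.id)) (*-congʳ (sign-swapFirst {n})))
                    (∏-cong λ i → M∘swap i (π ⟨$⟩ʳ (swapFirst ⟨$⟩ʳ i))) ⟩
        (- 1# * sign π) * (∏ λ i → M (swapFirst ⟨$⟩ʳ i) (π ⟨$⟩ʳ (swapFirst ⟨$⟩ʳ i)))
          ≈⟨ *-congˡ (∏-permute (λ i → M i (π ⟨$⟩ʳ i)) swapFirst) ⟨
        (- 1# * sign π) * (∏ λ i → M i (π ⟨$⟩ʳ i))
          ≈⟨ *-assoc _ _ _ ⟩
        - 1# * det-term M π ∎

    -- Equal rows below the first stay equal in every minor, so Laplace expansion lowers both
    -- indices together until they are 0 and 1.
    det-alternating : Alternating (det {n})
    det-alternating {suc (suc n)} zero (suc zero) eq {M} M≈ = det-swapFirst {M = M} M≈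
    det-alternating {suc n} (suc i) (suc i′) eq {M} M≈ = trans (det-laplace M)
      (∑-zero (allFin (suc n)) λ j _ → trans
        (*-congˡ (trans
          (*-congˡ (det-alternating i i′ (ℕ.suc-injective eq) {minor M j} λ k → M≈ (punchIn j k)))
          (zeroʳ _)))
        (zeroʳ _))

    -- Subtracting x₀ times the preceding column turns the first row into (1, 0, ..., 0) and the
    -- other entries beyond the first column into (xᵢ - x₀) xᵢ^k. The factor xᵢ - x₀ then leaves row
    -- i. The two transpositions turn the column operation into `addPrevious` and back.
    vandermonde : ∀ (x : Fin n → K) → det (λ i j → x i ^ toℕ j) ≈ ∏< λ i j → x j - x i
    vandermonde {zero}  x = trans (+-identityʳ _) (*-identityˡ 1#)
    vandermonde {suc n} x = begin
      det (λ i j → x i ^ toℕ j)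
        ≈⟨ det-transpose {suc n} (λ i j → x i ^ toℕ j) ⟨
      det (λ j i → x i ^ toℕ j)
        ≈⟨ alternating-addPrevious det det-cong det-linear det-alternating (- x zero) (λ j i → x i ^ toℕ j) ⟨
      det (addPrevious (- x zero) (λ j i → x i ^ toℕ j))
        ≈⟨ det-cong entry ⟩
      det (λ j i → W i j)
        ≈⟨ det-transpose W ⟩
      det W
        ≈⟨ det-laplace W ⟩
      (∑ (allFin (suc n)) λ j → W zero j * (headSign j * det (minor W j)))
        ≈⟨ ∑-single ≡.sym (Unique.allFin⁺ (suc n)) (∈-allFin zero) _ row₀ ⟩
      1# * (headSign {n} zero * det (minor W zero))
        ≈⟨ trans (*-identityˡ _) (trans (*-congʳ (headSign-zero {n})) (*-identityˡ _)) ⟩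
      det (λ i k → (x (suc i) - x zero) * x (suc i) ^ toℕ k)
        ≈⟨ det-scale (λ i → x (suc i) - x zero) (λ i k → x (suc i) ^ toℕ k) ⟩
      (∏ λ i → x (suc i) - x zero) * det (λ i k → x (suc i) ^ toℕ k)
        ≈⟨ *-congˡ (vandermonde (x ∘ suc)) ⟩
      (∏ λ i → x (suc i) - x zero) * (∏< λ i j → x (suc j) - x (suc i))
        ≈⟨ *-cong (*-identityˡ _) (∏-cong {n} λ i → *-identityˡ _) ⟨
      (∏< λ i j → x j - x i) ∎
      where
      W : Fin (suc n) → Fin (suc n) → K
      W i zero    = 1#
      W i (suc k) = (x i - x zero) * x i ^ toℕ k

      entry : ∀ j i → addPrevious (- x zero) (λ j i → x i ^ toℕ j) j i ≈ W i j
      entry zero    i = refl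
      entry (suc k) i = begin
        x i * x i ^ toℕ k + - x zero * x i ^ toℕ (inject₁ k)
          ≡⟨ ≡.cong (λ e → x i * x i ^ toℕ k + - x zero * x i ^ e) (Fin.toℕ-inject₁ k) ⟩
        x i * x i ^ toℕ k + - x zero * x i ^ toℕ k
          ≈⟨ distribʳ _ _ _ ⟨
        (x i - x zero) * x i ^ toℕ k ∎

      row₀ : ∀ j → ¬ zero ≡ j → W zero j * (headSign j * det (minor W j)) ≈ 0#
      row₀ zero    z≢z = contradiction ≡.refl z≢z
      row₀ (suc k) _   = trans (*-congʳ (trans (*-congʳ (-‿inverseʳ (x zero))) (zeroˡ _))) (zeroˡ _)

    -- The factors are opposite to those of `vandermonde`; squaring removes the difference.
    vandermonde-square : ∀ (x : Fin n → K) →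
      (∏< λ i j → x i - x j) * (∏< λ i j → x i - x j) ≈ det (λ i j → x i ^ toℕ j) * det (λ i j → x i ^ toℕ j)
    vandermonde-square x = begin
      (∏< λ i j → x i - x j) * (∏< λ i j → x i - x j)
        ≈⟨ ∏<-distrib-* (λ i j → x i - x j) (λ i j → x i - x j) ⟨
      (∏< λ i j → (x i - x j) * (x i - x j))
        ≈⟨ ∏<-cong (λ i j _ → flip-square (x i) (x j)) ⟩
      (∏< λ i j → (x j - x i) * (x j - x i))
        ≈⟨ ∏<-distrib-* (λ i j → x j - x i) (λ i j → x j - x i) ⟩
      (∏< λ i j → x j - x i) * (∏< λ i j → x j - x i)
        ≈⟨ *-cong (vandermonde x) (vandermonde x) ⟨
      det (λ i j → x i ^ toℕ j) * det (λ i j → x i ^ toℕ j) ∎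
      where
      flip-square : ∀ a b → (a - b) * (a - b) ≈ (b - a) * (b - a)
      flip-square a b = begin
        (a - b) * (a - b)         ≈⟨ *-cong (⁻¹-anti-homo-// b a) (⁻¹-anti-homo-// b a) ⟨
        - (b - a) * - (b - a)     ≈⟨ -‿distribˡ-* _ _ ⟨
        - ((b - a) * - (b - a))   ≈⟨ -‿cong (-‿distribʳ-* _ _) ⟨
        - - ((b - a) * (b - a))   ≈⟨ -‿involutive _ ⟩
        (b - a) * (b - a)         ∎

  -- Powers of sums, tuples of permutations and the sign of the reversal

  square-≈⇒^-≈ : ∀ {x y} → x * x ≈ y * y → ∀ k → x ^ (2 ℕ.* k) ≈ y ^ (2 ℕ.* k)
  square-≈⇒^-≈ {x} {y} x²≈y² k = begin
    x ^ (2 ℕ.* k)  ≈⟨ ^-assocʳ x 2 k ⟨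
    (x ^ 2) ^ k    ≈⟨ ^-congˡ k (trans (*-congˡ (*-identityʳ x)) (trans x²≈y² (*-congˡ (sym (*-identityʳ y))))) ⟩
    (y ^ 2) ^ k    ≈⟨ ^-assocʳ y 2 k ⟩
    y ^ (2 ℕ.* k)  ∎

  ∑-^ : ∀ (xs : List A) (f : A → K) m →
        ∑ xs f ^ m ≈ ∑ (tuples xs m) λ v → Vec.foldr′ _*_ 1# (Vec.map f v)
  ∑-^ xs f zero    = sym (+-identityʳ 1#)
  ∑-^ xs f (suc m) = begin
    ∑ xs f * ∑ xs f ^ m
      ≈⟨ *-congˡ (∑-^ xs f m) ⟩
    ∑ xs f * ∑ (tuples xs m) F
      ≈⟨ *-distribʳ-∑ xs _ f ⟩
    (∑ xs λ x → f x * ∑ (tuples xs m) F)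
      ≈⟨ ∑-cong xs (λ x → *-distribˡ-∑ (tuples xs m) (f x) F) ⟩
    (∑ xs λ x → ∑ (tuples xs m) λ v → f x * F v)
      ≈⟨ ∑-cartesianProductWith _∷_ xs (tuples xs m) (λ v → Vec.foldr′ _*_ 1# (Vec.map f v)) ⟨
    (∑ (tuples xs (suc m)) λ v → Vec.foldr′ _*_ 1# (Vec.map f v)) ∎
    where
    F : ∀ {m} → Vec _ m → K
    F v = Vec.foldr′ _*_ 1# (Vec.map f v)

  ∑-tuples-reindex : ∀ (φ : Inverse (permutationSetoid n) (permutationSetoid n)) m →
    (F : Vec (Permutation′ n) m → K) → (∀ {σs τs} → σs ≈ᵛ τs → F σs ≈ F τs) →
    (∑ (tuples (𝔖 n) m) λ σs → F (Vec.map (Inverse.to φ) σs)) ≈ ∑ (tuples (𝔖 n) m) F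
  ∑-tuples-reindex φ zero    F F-resp = refl
  ∑-tuples-reindex {n} φ (suc m) F F-resp = begin
    (∑ (tuples (𝔖 n) (suc m)) λ σs → F (Vec.map to σs))
      ≈⟨ ∑-cartesianProductWith _∷_ (𝔖 n) (tuples (𝔖 n) m) (λ σs → F (Vec.map to σs)) ⟩
    (∑ (𝔖 n) λ σ → ∑ (tuples (𝔖 n) m) λ σs → F (to σ ∷ Vec.map to σs))
      ≈⟨ ∑-cong (𝔖 n) (λ σ → ∑-tuples-reindex φ m (λ σs → F (to σ ∷ σs))
           λ eq → F-resp λ { zero _ → ≡.refl ; (suc j) → eq j }) ⟩
    (∑ (𝔖 n) λ σ → ∑ (tuples (𝔖 n) m) λ σs → F (to σ ∷ σs))
      ≈⟨ ∑-𝔖-reindex φ (λ σ → ∑ (tuples (𝔖 n) m) λ σs → F (σ ∷ σs))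
           (λ eq → ∑-cong (tuples (𝔖 n) m) λ σs → F-resp λ { zero → eq ; (suc j) _ → ≡.refl }) ⟩
    (∑ (𝔖 n) λ σ → ∑ (tuples (𝔖 n) m) λ σs → F (σ ∷ σs))
      ≈⟨ ∑-cartesianProductWith _∷_ (𝔖 n) (tuples (𝔖 n) m) F ⟨
    ∑ (tuples (𝔖 n) (suc m)) F ∎
    where open Inverse φ using (to)

  1^n≈1 : ∀ n → 1# ^ n ≈ 1#
  1^n≈1 zero    = refl
  1^n≈1 (suc n) = trans (*-identityˡ _) (1^n≈1 n)

  -- Meant for the sign of σ₀ times that of the reversal, which is raised to the odd number 2k + 1
  -- of substituted permutations.
  square-one⇒^-odd : ∀ {x} → x * x ≈ 1# → ∀ k → x ^ (2 ℕ.* k ℕ.+ 1) ≈ x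
  square-one⇒^-odd {x} x²≈1 k = begin
    x ^ (2 ℕ.* k ℕ.+ 1)      ≈⟨ ^-homo-* x (2 ℕ.* k) 1 ⟩
    x ^ (2 ℕ.* k) * x ^ 1    ≈⟨ *-cong (square-≈⇒^-≈ (trans x²≈1 (sym (*-identityˡ 1#))) k) (*-identityʳ x) ⟩
    1# ^ (2 ℕ.* k) * x       ≈⟨ *-congʳ (1^n≈1 (2 ℕ.* k)) ⟩
    1# * x                   ≈⟨ *-identityˡ x ⟩
    x                        ∎

  -- The pairs containing 0 contribute n factors, which matches the recursion of the triangular
  -- numbers.
  ∏<-constant : ∀ n x → ∏< {n} (λ _ _ → x) ≈ x ^ (n ℕ.* (n ℕ.∸ 1) ℕ./ 2)
  ∏<-constant zero    x = refl
  ∏<-constant (suc n) x = begin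
    ∏< {suc n} (λ _ _ → x)
      ≈⟨ *-cong (*-identityˡ _) (∏-cong {n} λ i → *-identityˡ _) ⟩
    ∏ {n} (λ _ → x) * ∏< {n} (λ _ _ → x)
      ≈⟨ *-cong (∏-constant n) (∏<-constant n x) ⟩
    x ^ n * x ^ (n ℕ.* (n ℕ.∸ 1) ℕ./ 2)
      ≈⟨ ^-homo-* x n (n ℕ.* (n ℕ.∸ 1) ℕ./ 2) ⟨
    x ^ (n ℕ.+ n ℕ.* (n ℕ.∸ 1) ℕ./ 2)
      ≡⟨ ≡.cong (x ^_) (triangular-suc n) ⟨
    x ^ (suc n ℕ.* n ℕ./ 2) ∎
    where
    ∏-constant : ∀ m → ∏ {m} (λ _ → x) ≈ x ^ m
    ∏-constant zero    = refl
    ∏-constant (suc m) = *-congˡ (∏-constant m)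

  -- Every pair is an inversion of the reversal.
  sign-reverse : ∀ n → sign {n} reverse ≈ (- 1#) ^ (n ℕ.* (n ℕ.∸ 1) ℕ./ 2)
  sign-reverse n = trans
    (∏<-cong {n} λ i j i<j → reflexive (if-yes (opposite j Fin.<? opposite i) (opposite-< i j i<j)))
    (∏<-constant n (- 1#))

  sign-foldr : ∀ (σs : Vec (Permutation′ n) m) →
               sign (Vec.foldr′ _∘ₚ_ Perm.id σs) ≈ Vec.foldr′ _*_ 1# (Vec.map sign σs)
  sign-foldr {n} []  = sign-id {n}
  sign-foldr (σ ∷ σs) = trans (sign-∘ σ (Vec.foldr′ _∘ₚ_ Perm.id σs)) (*-congˡ (sign-foldr σs))

module ℚR = RingTheory ℚ.+-*-commutativeRing

-- Negation moves a nonzero numerator to the opposite constructor, so the equation is absurd unless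
-- the numerator is 0.
p≡-p⇒p≡0 : ∀ {p} → p ≡ ℚ.- p → p ≡ 0ℚ
p≡-p⇒p≡0 {p@(mkℚ +0 _ _)}       _  = ℚ.↥p≡0⇒p≡0 p ≡.refl
p≡-p⇒p≡0 {mkℚ +[1+ _ ] _ _} ()
p≡-p⇒p≡0 {mkℚ -[1+ _ ] _ _} ()

-- Polynomials

infix 4 _≟ᵉ_
_≟ᵉ_ : (α β : Vec ℕ n) → Dec (α ≡ β)
_≟ᵉ_ = Vec.≡-dec ℕ._≟_

infixl 6 _⊕_
_⊕_ _⊖_ : Vec ℕ n → Vec ℕ n → Vec ℕ n
_⊕_ = zipWith ℕ._+_
_⊖_ = zipWith ℕ._∸_

⊕-⊖ : ∀ (β γ : Vec ℕ n) → (β ⊕ γ) ⊖ β ≡ γ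
⊕-⊖ []      []      = ≡.refl
⊕-⊖ (b ∷ β) (c ∷ γ) = ≡.cong₂ _∷_ (ℕ.m+n∸m≡n b c) (⊕-⊖ β γ)

module _ {n : ℕ} where
  open RawRing (polynomialRawRing n)
  open ≡.≡-Reasoning

  -- Agda cannot recover p and q from p ≈ q, which unfolds; hence the wrapper.
  infix 4 _≋_
  record _≋_ (p q : Polynomial n) : Set where
    constructor mk≋
    field coefficients : p ≈ q
  open _≋_ public

  private
    term : Vec ℕ n → ℚ × Vec ℕ n → ℚ
    term α (c , β) = if does (β ≟ᵉ α) then c else 0ℚ

    _⊛_ : ℚ × Vec ℕ n → ℚ × Vec ℕ n → ℚ × Vec ℕ n
    (c , α) ⊛ (d , β) = c ℚ.* d , α ⊕ β

    ⊛-comm : ∀ s t → s ⊛ t ≡ t ⊛ s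
    ⊛-comm (c , α) (d , β) = ≡.cong₂ _,_ (ℚ.*-comm c d) (Vec.zipWith-comm ℕ.+-comm α β)

    ⊛-assoc : ∀ s t u → (s ⊛ t) ⊛ u ≡ s ⊛ (t ⊛ u)
    ⊛-assoc (c , α) (d , β) (e , γ) =
      ≡.cong₂ _,_ (ℚ.*-assoc c d e) (Vec.zipWith-assoc ℕ.+-assoc α β γ)

    ⊛-identityˡ : ∀ s → (1ℚ , replicate n 0) ⊛ s ≡ s
    ⊛-identityˡ (c , α) = ≡.cong₂ _,_ (ℚ.*-identityˡ c) (Vec.zipWith-identityˡ ℕ.+-identityˡ α)

  coefficient-++ : ∀ p q α → coefficient (p ++ q) α ≡ coefficient p α ℚ.+ coefficient q α
  coefficient-++ p q α = ℚR.∑-++ p q (term α)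

  coefficient-neg : ∀ p α → coefficient (- p) α ≡ ℚ.- coefficient p α
  coefficient-neg []            α = ≡.refl
  coefficient-neg ((c , β) ∷ p) α = begin
    term α (ℚ.- c , β) ℚ.+ coefficient (- p) α
      ≡⟨ ≡.cong₂ ℚ._+_ neg-if (coefficient-neg p α) ⟩
    (ℚ.- term α (c , β)) ℚ.+ (ℚ.- coefficient p α)
      ≡⟨ ℚ.neg-distrib-+ (term α (c , β)) (coefficient p α) ⟨
    ℚ.- (term α (c , β) ℚ.+ coefficient p α) ∎
    where
    neg-if : term α (ℚ.- c , β) ≡ ℚ.- term α (c , β)
    neg-if with does (β ≟ᵉ α)
    ... | true  = ≡.refl
    ... | false = ≡.refl

  coefficient-∑ : ∀ (xs : List A) (f : A → Polynomial n) α →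
    coefficient (RingNotation.∑ (polynomialRawRing n) xs f) α ≡ ℚ′.∑ xs λ x → coefficient (f x) α
  coefficient-∑ []       f α = ≡.refl
  coefficient-∑ (x ∷ xs) f α =
    ≡.trans (coefficient-++ (f x) _ α) (≡.cong (coefficient (f x) α ℚ.+_) (coefficient-∑ xs f α))

  coefficient-*′ : ∀ p q α → coefficient (p * q) α ≡ ℚ′.∑ p λ s → ℚ′.∑ q λ t → term α (s ⊛ t)
  coefficient-*′ p q α = ℚR.∑-cartesianProductWith _⊛_ p q (term α)

  -- The coefficient of z^α in z^β · q.  It involves q through its coefficients only,
  -- which makes multiplication respect ≋.
  shifted : Vec ℕ n → Polynomial n → Vec ℕ n → ℚ
  shifted β q α = if does ((β ⊕ (α ⊖ β)) ≟ᵉ α) then coefficient q (α ⊖ β) else 0ℚ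

  -- β ⊕ γ = α forces γ = α ⊖ β. As `⊖` truncates, the test in `shifted` decides whether z^β divides
  -- z^α; if it does not, no term of q contributes.
  ∑-shifted : ∀ c β q α → (ℚ′.∑ q λ t → term α ((c , β) ⊛ t)) ≡ c ℚ.* shifted β q α
  ∑-shifted c β q α = by-cases ((β ⊕ (α ⊖ β)) ≟ᵉ α)
    where
    entry : β ⊕ (α ⊖ β) ≡ α → ∀ d γ → Dec (γ ≡ α ⊖ β) →
            term α ((c , β) ⊛ (d , γ)) ≡ c ℚ.* term (α ⊖ β) (d , γ)
    entry eq d γ (yes ≡.refl) = ≡.trans
      (if-yes ((β ⊕ (α ⊖ β)) ≟ᵉ α) eq)
      (≡.cong (c ℚ.*_) (≡.sym (if-yes ((α ⊖ β) ≟ᵉ (α ⊖ β)) ≡.refl)))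
    entry eq d γ (no γ≢) = ≡.trans
      (if-no ((β ⊕ γ) ≟ᵉ α) λ { ≡.refl → γ≢ (≡.sym (⊕-⊖ β γ)) })
      (≡.sym (≡.trans (≡.cong (c ℚ.*_) (if-no (γ ≟ᵉ (α ⊖ β)) γ≢)) (ℚ.*-zeroʳ c)))

    by-cases : Dec (β ⊕ (α ⊖ β) ≡ α) → (ℚ′.∑ q λ t → term α ((c , β) ⊛ t)) ≡ c ℚ.* shifted β q α
    by-cases (yes eq) = begin
      (ℚ′.∑ q λ t → term α ((c , β) ⊛ t))
        ≡⟨ ℚR.∑-cong q (λ (d , γ) → entry eq d γ (γ ≟ᵉ (α ⊖ β))) ⟩
      (ℚ′.∑ q λ t → c ℚ.* term (α ⊖ β) t)
        ≡⟨ ℚR.*-distribˡ-∑ q c (term (α ⊖ β)) ⟨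
      c ℚ.* coefficient q (α ⊖ β)
        ≡⟨ ≡.cong (c ℚ.*_) (if-yes ((β ⊕ (α ⊖ β)) ≟ᵉ α) eq) ⟨
      c ℚ.* shifted β q α ∎
    by-cases (no neq) = begin
      (ℚ′.∑ q λ t → term α ((c , β) ⊛ t))
        ≡⟨ ℚR.∑-zero q (λ { (d , γ) _ → if-no ((β ⊕ γ) ≟ᵉ α) λ { ≡.refl →
             neq (≡.cong (β ⊕_) (⊕-⊖ β γ)) } }) ⟩
      0ℚ
        ≡⟨ ≡.trans (≡.cong (c ℚ.*_) (if-no ((β ⊕ (α ⊖ β)) ≟ᵉ α) neq)) (ℚ.*-zeroʳ c) ⟨
      c ℚ.* shifted β q α ∎

  coefficient-* : ∀ p q α → coefficient (p * q) α ≡ ℚ′.∑ p λ (c , β) → c ℚ.* shifted β q α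
  coefficient-* p q α =
    ≡.trans (coefficient-*′ p q α) (ℚR.∑-cong p λ (c , β) → ∑-shifted c β q α)

  *-congʳ-≋ : ∀ p {q r} → q ≋ r → p * q ≋ p * r
  *-congʳ-≋ p {q} {r} (mk≋ q≈r) = mk≋ λ α → begin
    coefficient (p * q) α
      ≡⟨ coefficient-* p q α ⟩
    (ℚ′.∑ p λ (c , β) → c ℚ.* shifted β q α)
      ≡⟨ ℚR.∑-cong p (λ (c , β) → ≡.cong (λ x → c ℚ.*
           (if does ((β ⊕ (α ⊖ β)) ≟ᵉ α) then x else 0ℚ)) (q≈r (α ⊖ β))) ⟩
    (ℚ′.∑ p λ (c , β) → c ℚ.* shifted β r α)
      ≡⟨ coefficient-* p r α ⟨
    coefficient (p * r) α ∎

  *-comm-≋ : ∀ p q → p * q ≋ q * p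
  *-comm-≋ p q = mk≋ λ α → begin
    coefficient (p * q) α
      ≡⟨ coefficient-*′ p q α ⟩
    (ℚ′.∑ p λ s → ℚ′.∑ q λ t → term α (s ⊛ t))
      ≡⟨ ℚR.∑-comm p q (λ s t → term α (s ⊛ t)) ⟩
    (ℚ′.∑ q λ t → ℚ′.∑ p λ s → term α (s ⊛ t))
      ≡⟨ ℚR.∑-cong q (λ t → ℚR.∑-cong p λ s → ≡.cong (term α) (⊛-comm s t)) ⟩
    (ℚ′.∑ q λ t → ℚ′.∑ p λ s → term α (t ⊛ s))
      ≡⟨ coefficient-*′ q p α ⟨
    coefficient (q * p) α ∎

  *-assoc-≋ : ∀ p q r → (p * q) * r ≋ p * (q * r)
  *-assoc-≋ p q r = mk≋ λ α → begin
    coefficient ((p * q) * r) α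
      ≡⟨ coefficient-*′ (p * q) r α ⟩
    (ℚ′.∑ (p * q) λ st → ℚ′.∑ r λ u → term α (st ⊛ u))
      ≡⟨ ℚR.∑-cartesianProductWith _⊛_ p q (λ st → ℚ′.∑ r λ u → term α (st ⊛ u)) ⟩
    (ℚ′.∑ p λ s → ℚ′.∑ q λ t → ℚ′.∑ r λ u → term α ((s ⊛ t) ⊛ u))
      ≡⟨ ℚR.∑-cong p (λ s → ℚR.∑-cong q λ t → ℚR.∑-cong r λ u →
           ≡.cong (term α) (⊛-assoc s t u)) ⟩
    (ℚ′.∑ p λ s → ℚ′.∑ q λ t → ℚ′.∑ r λ u → term α (s ⊛ (t ⊛ u)))
      ≡⟨ ℚR.∑-cong p (λ s → ℚR.∑-cartesianProductWith _⊛_ q r (λ tu → term α (s ⊛ tu))) ⟨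
    (ℚ′.∑ p λ s → ℚ′.∑ (q * r) λ tu → term α (s ⊛ tu))
      ≡⟨ coefficient-*′ p (q * r) α ⟨
    coefficient (p * (q * r)) α ∎

  *-identityˡ-≋ : ∀ p → 1# * p ≋ p
  *-identityˡ-≋ p = mk≋ λ α → begin
    coefficient (1# * p) α
      ≡⟨ coefficient-*′ 1# p α ⟩
    (ℚ′.∑ p λ t → term α ((1ℚ , replicate n 0) ⊛ t)) ℚ.+ 0ℚ
      ≡⟨ ℚ.+-identityʳ _ ⟩
    (ℚ′.∑ p λ t → term α ((1ℚ , replicate n 0) ⊛ t))
      ≡⟨ ℚR.∑-cong p (λ t → ≡.cong (term α) (⊛-identityˡ t)) ⟩
    coefficient p α ∎

  ++-cong-≋ : ∀ {p q r s} → p ≋ q → r ≋ s → p ++ r ≋ q ++ s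
  ++-cong-≋ {p} {q} {r} {s} (mk≋ p≈q) (mk≋ r≈s) = mk≋ λ α → ≡.trans (coefficient-++ p r α)
    (≡.trans (≡.cong₂ ℚ._+_ (p≈q α) (r≈s α)) (≡.sym (coefficient-++ q s α)))

  ++-comm-≋ : ∀ p q → p ++ q ≋ q ++ p
  ++-comm-≋ p q = mk≋ λ α → ≡.trans (coefficient-++ p q α)
    (≡.trans (ℚ.+-comm (coefficient p α) (coefficient q α)) (≡.sym (coefficient-++ q p α)))

  neg-inverseˡ-≋ : ∀ p → - p ++ p ≋ []
  neg-inverseˡ-≋ p = mk≋ λ α → ≡.trans (coefficient-++ (- p) p α)
    (≡.trans (≡.cong (ℚ._+ coefficient p α) (coefficient-neg p α)) (ℚ.+-inverseˡ (coefficient p α)))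

  polynomialRing : CommutativeRing _ _
  polynomialRing = record
    { Carrier = Polynomial n
    ; _≈_     = _≋_
    ; _+_     = _+_
    ; _*_     = _*_
    ; -_      = -_
    ; 0#      = 0#
    ; 1#      = 1#
    ; isCommutativeRing = record
      { isRing = record
        { +-isAbelianGroup = record
          { isGroup = record
            { isMonoid = record
              { isSemigroup = record
                { isMagma = record { isEquivalence = isEquivalence ; ∙-cong = ++-cong-≋ }
                ; assoc   = λ p q r → reflexive (List.++-assoc p q r)
                }
              ; identity = (λ _ → reflexive ≡.refl) , λ p → reflexive (List.++-identityʳ p)
              }
            ; inverse = neg-inverseˡ-≋
                      , λ p → trans (++-comm-≋ p (- p)) (neg-inverseˡ-≋ p)
            ; ⁻¹-cong = neg-cong
            }
          ; comm = ++-comm-≋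
          }
        ; *-cong     = λ {p} {q} {r} {s} p≋q r≋s → trans (*-congʳ-≋ p r≋s)
            (trans (*-comm-≋ p s) (trans (*-congʳ-≋ s p≋q) (*-comm-≋ s q)))
        ; *-assoc    = *-assoc-≋
        ; *-identity = *-identityˡ-≋ , λ p → trans (*-comm-≋ p 1#) (*-identityˡ-≋ p)
        ; distrib    = (λ p q r → trans (*-comm-≋ p (q ++ r)) (trans (distribʳ p q r)
                         (++-cong-≋ (*-comm-≋ q p) (*-comm-≋ r p))))
                     , distribʳ
        }
      ; *-comm = *-comm-≋
      }
    }
    where
    reflexive : ∀ {p q} → p ≡ q → p ≋ q
    reflexive ≡.refl = mk≋ λ _ → ≡.refl

    trans : ∀ {p q r} → p ≋ q → q ≋ r → p ≋ r
    trans (mk≋ p≈q) (mk≋ q≈r) = mk≋ λ α → ≡.trans (p≈q α) (q≈r α)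

    isEquivalence : IsEquivalence _≋_
    isEquivalence = record
      { refl  = reflexive ≡.refl
      ; sym   = λ (mk≋ p≈q) → mk≋ λ α → ≡.sym (p≈q α)
      ; trans = trans
      }

    neg-cong : ∀ {p q} → p ≋ q → - p ≋ - q
    neg-cong {p} {q} (mk≋ p≈q) = mk≋ λ α → ≡.trans (coefficient-neg p α)
      (≡.trans (≡.cong ℚ.-_ (p≈q α)) (≡.sym (coefficient-neg q α)))

    distribʳ : ∀ p q r → (q ++ r) * p ≋ (q * p) ++ (r * p)
    distribʳ p q r = reflexive (List.cartesianProductWith-distribʳ-++ _ q r p)

-- Monomials, alternants and their powers

∑ℕ : (Fin n → ℕ) → ℕ
∑ℕ = MonoidSum⁻.sum ℕ.+-0-monoid

∑ℕ-zero : ∀ n → ∑ℕ {n} (λ _ → 0) ≡ 0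
∑ℕ-zero = MonoidSum⁻.sum-replicate-zero ℕ.+-0-monoid

∑ℕ-single : ∀ (e : Fin n → ℕ) j → ∑ℕ (λ i → if does (i Fin.≟ j) then e i else 0) ≡ e j
∑ℕ-single {suc n} e zero    = ≡.trans (≡.cong (e zero ℕ.+_) (∑ℕ-zero n)) (ℕ.+-identityʳ _)
∑ℕ-single {suc n} e (suc j) = ∑ℕ-single (e ∘ suc) j

tabulate-⊕ : ∀ (f g : Fin n → ℕ) → tabulate f ⊕ tabulate g ≡ tabulate (λ i → f i ℕ.+ g i)
tabulate-⊕ {zero}  f g = ≡.refl
tabulate-⊕ {suc n} f g = ≡.cong (f zero ℕ.+ g zero ∷_) (tabulate-⊕ (f ∘ suc) (g ∘ suc))

replicate≡tabulate : ∀ n → replicate n 0 ≡ tabulate (λ _ → 0)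
replicate≡tabulate zero    = ≡.refl
replicate≡tabulate (suc n) = ≡.cong (0 ∷_) (replicate≡tabulate n)

tabulate-injective : ∀ {f g : Fin n → A} → tabulate f ≡ tabulate g → ∀ i → f i ≡ g i
tabulate-injective {f = f} {g} eq i = ≡.trans (≡.sym (Vec.lookup∘tabulate f i))
  (≡.trans (≡.cong (λ v → lookup v i) eq) (Vec.lookup∘tabulate g i))

-- Coefficient, and below it the exponents, of the term that a tuple of m permutations contributes
-- to A^m.
signs : Vec (Permutation′ n) m → ℚ
signs σs = Vec.foldr′ ℚ._*_ 1ℚ (Vec.map ℚ′.sign σs)

exponents : Vec (Permutation′ n) m → Fin n → ℕ
exponents σs i = Vec.sum (Vec.map (λ σ → toℕ (σ ⟨$⟩ʳ i)) σs)

module _ {n : ℕ} where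
  open CommutativeRing (polynomialRing {n}) using (setoid; refl; sym; trans; reflexive; semiring; *-monoid
    ; *-congˡ; *-congʳ; *-identityʳ)
  open RawRing (polynomialRawRing n) using (_*_; -_; 1#)
  module ℚ[z] = RingNotation (CommutativeRing.rawRing (polynomialRing {n}))
  open ℚ[z] using (_^_; det)
  open RingTheory (polynomialRing {n}) using (∑-cong)
  open SetoidReasoning setoid

  private
    ∏-cong-≡ : ∀ {f g : Fin m → Polynomial n} → (∀ i → f i ≡ g i) → ℚ[z].∏ f ≡ ℚ[z].∏ g
    ∏-cong-≡ = MonoidSum⁻.sum-cong-≗ *-monoid

  -- A product of one-term lists is a one-term list, so monomials can be multiplied up to ≡ and not
  -- just up to `≋`.
  monomial : ℚ → Vec ℕ n → Polynomial n
  monomial c α = (c , α) ∷ []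

  coefficient-monomial : ∀ c β α →
    coefficient (monomial c β) α ≡ (if does (β ≟ᵉ α) then c else 0ℚ)
  coefficient-monomial c β α = ℚ.+-identityʳ _

  const-*-monomial : ∀ c d β → const c * monomial d β ≡ monomial (c ℚ.* d) β
  const-*-monomial c d β = ≡.cong (monomial (c ℚ.* d)) (Vec.zipWith-identityˡ ℕ.+-identityˡ β)

  coefficient-const-* : ∀ c p α → coefficient (const c * p) α ≡ c ℚ.* coefficient p α
  coefficient-const-* c p α = ≡.trans (coefficient-* (const c) p α)
    (≡.trans (ℚ.+-identityʳ _) (≡.cong (c ℚ.*_) shifted-zero))
    where
    ⊖-zero : ∀ {m} (α : Vec ℕ m) → α ⊖ replicate m 0 ≡ α
    ⊖-zero []      = ≡.refl
    ⊖-zero (_ ∷ α) = ≡.cong (_ ∷_) (⊖-zero α)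

    shifted-zero : shifted (replicate n 0) p α ≡ coefficient p α
    shifted-zero = ≡.trans
      (if-yes ((replicate n 0 ⊕ (α ⊖ replicate n 0)) ≟ᵉ α)
        (≡.trans (Vec.zipWith-identityˡ ℕ.+-identityˡ _) (⊖-zero α)))
      (≡.cong (coefficient p) (⊖-zero α))

  ∏-const : ∀ (c : Fin m → ℚ) → ℚ[z].∏ (const ∘ c) ≡ const (ℚ′.∏ c)
  ∏-const {zero}  c = ≡.refl
  ∏-const {suc m} c = ≡.trans (≡.cong (const (c zero) *_) (∏-const (c ∘ suc)))
    (const-*-monomial (c zero) _ _)

  sign-const : ∀ (π : Permutation′ m) → ℚ[z].sign π ≡ const (ℚ′.sign π)
  sign-const π = ≡.trans
    (∏-cong-≡ λ i → ≡.trans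
      (∏-cong-≡ λ j → ≡.sym (entry (does (i Fin.<? j)) (does ((π ⟨$⟩ʳ j) Fin.<? (π ⟨$⟩ʳ i)))))
      (∏-const (factor i)))
    (∏-const λ i → ℚ′.∏ (factor i))
    where
    factor : Fin _ → Fin _ → ℚ
    factor i j = if does (i Fin.<? j)
      then (if does ((π ⟨$⟩ʳ j) Fin.<? (π ⟨$⟩ʳ i)) then ℚ.- 1ℚ else 1ℚ) else 1ℚ

    entry : ∀ a b → const (if a then (if b then ℚ.- 1ℚ else 1ℚ) else 1ℚ) ≡ (if a then (if b then - 1# else 1#) else 1#)
    entry true  true  = ≡.refl
    entry true  false = ≡.refl
    entry false b     = ≡.refl

  z-^ : ∀ i e → z i ^ e ≡ monomial 1ℚ (tabulate λ j → if does (i Fin.≟ j) then e else 0)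
  z-^ i zero = ≡.cong (monomial 1ℚ) (≡.trans (replicate≡tabulate n)
    (Vec.tabulate-cong λ j → ≡.sym (Bool.if-eta (does (i Fin.≟ j)))))
  z-^ i (suc e) = ≡.trans (≡.cong (z i *_) (z-^ i e)) (≡.cong (monomial 1ℚ)
    (≡.trans (tabulate-⊕ _ _) (Vec.tabulate-cong λ j → entry (does (i Fin.≟ j)))))
    where
    entry : ∀ b → (if b then 1 else 0) ℕ.+ (if b then e else 0) ≡ (if b then suc e else 0)
    entry true  = ≡.refl
    entry false = ≡.refl

  ∏-monomial : ∀ (f : Fin m → Fin n → ℕ) →
    ℚ[z].∏ (λ i → monomial 1ℚ (tabulate (f i))) ≡ monomial 1ℚ (tabulate λ j → ∑ℕ λ i → f i j)
  ∏-monomial {zero}  f = ≡.cong (monomial 1ℚ) (replicate≡tabulate n)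
  ∏-monomial {suc m} f = ≡.trans (≡.cong (monomial 1ℚ (tabulate (f zero)) *_) (∏-monomial (f ∘ suc)))
    (≡.cong (monomial 1ℚ) (tabulate-⊕ _ _))

  ∏-z-^ : ∀ (e : Fin n → ℕ) → ℚ[z].∏ (λ i → z i ^ e i) ≡ monomial 1ℚ (tabulate e)
  ∏-z-^ e = ≡.trans (∏-cong-≡ λ i → z-^ i (e i)) (≡.trans
    (∏-monomial (λ i j → if does (i Fin.≟ j) then e i else 0))
    (≡.cong (monomial 1ℚ) (Vec.tabulate-cong (∑ℕ-single e))))

  -- A is `alternant toℕ`, and the dividend in the definition of s_μ is `alternant (exponent μ)`.
  alternant : (Fin n → ℕ) → Polynomial n
  alternant e = det λ i j → z i ^ e j

  alternant-expansion : ∀ e → alternant e ≋ ℚ[z].∑ (𝔖 n) λ π → monomial (ℚ′.sign π) (tabulate λ i → e (π ⟨$⟩ʳ i))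
  alternant-expansion e = ∑-cong (𝔖 n) λ π → reflexive (≡.trans
    (≡.cong₂ _*_ (sign-const π) (∏-z-^ (λ i → e (π ⟨$⟩ʳ i))))
    (≡.trans (const-*-monomial (ℚ′.sign π) 1ℚ (tabulate λ i → e (π ⟨$⟩ʳ i)))
      (≡.cong (λ c → monomial c (tabulate λ i → e (π ⟨$⟩ʳ i))) (ℚ.*-identityʳ (ℚ′.sign π)))))

  coefficient-alternant : ∀ e α → coefficient (alternant e) α ≡
    ℚ′.∑ (𝔖 n) λ π → if does (tabulate (λ i → e (π ⟨$⟩ʳ i)) ≟ᵉ α) then ℚ′.sign π else 0ℚ
  coefficient-alternant e α = ≡.trans (coefficients (alternant-expansion e) α) (≡.trans
    (coefficient-∑ (𝔖 n) (λ π → monomial (ℚ′.sign π) (tabulate λ i → e (π ⟨$⟩ʳ i))) α)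
    (ℚR.∑-cong (𝔖 n) λ π → coefficient-monomial (ℚ′.sign π) (tabulate λ i → e (π ⟨$⟩ʳ i)) α))

  coefficient-alternant-^ : ∀ m α → coefficient (alternant toℕ ^ m) α ≡
    ℚ′.∑ (tuples (𝔖 n) m) λ σs → if does (tabulate (exponents σs) ≟ᵉ α) then signs σs else 0ℚ
  coefficient-alternant-^ m α = ≡.trans (coefficients expansion α) (≡.trans
    (coefficient-∑ (tuples (𝔖 n) m) (λ σs → monomial (signs σs) (tabulate (exponents σs))) α)
    (ℚR.∑-cong (tuples (𝔖 n) m) λ σs → coefficient-monomial (signs σs) (tabulate (exponents σs)) α))
    where
    term : Permutation′ n → Polynomial n
    term π = monomial (ℚ′.sign π) (tabulate λ i → toℕ (π ⟨$⟩ʳ i))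

    product-term : ∀ {m} (σs : Vec (Permutation′ n) m) →
      Vec.foldr′ _*_ 1# (Vec.map term σs) ≡ monomial (signs σs) (tabulate (exponents σs))
    product-term []       = ≡.cong (monomial 1ℚ) (replicate≡tabulate n)
    product-term (σ ∷ σs) = ≡.trans (≡.cong (term σ *_) (product-term σs))
      (≡.cong (monomial _) (tabulate-⊕ _ _))

    expansion : alternant toℕ ^ m ≋
      ℚ[z].∑ (tuples (𝔖 n) m) λ σs → monomial (signs σs) (tabulate (exponents σs))
    expansion = begin
      alternant toℕ ^ m
        ≈⟨ SemiringExp.^-congˡ semiring m (alternant-expansion toℕ) ⟩
      ℚ[z].∑ (𝔖 n) term ^ m
        ≈⟨ RingTheory.∑-^ (polynomialRing {n}) (𝔖 n) term m ⟩
      (ℚ[z].∑ (tuples (𝔖 n) m) λ σs → Vec.foldr′ _*_ 1# (Vec.map term σs))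
        ≈⟨ ∑-cong (tuples (𝔖 n) m) (λ σs → reflexive (product-term σs)) ⟩
      (ℚ[z].∑ (tuples (𝔖 n) m) λ σs → monomial (signs σs) (tabulate (exponents σs))) ∎

  V^2k*alternant : ∀ k → V ^ (2 ℕ.* k) * alternant toℕ ≋ alternant toℕ ^ (2 ℕ.* k ℕ.+ 1)
  V^2k*alternant k = begin
    V ^ (2 ℕ.* k) * alternant toℕ
      ≈⟨ *-congʳ (square-≈⇒^-≈ (vandermonde-square torsion-free z) k) ⟩
    alternant toℕ ^ (2 ℕ.* k) * alternant toℕ
      ≈⟨ *-congˡ {alternant toℕ ^ (2 ℕ.* k)} (*-identityʳ (alternant toℕ)) ⟨
    alternant toℕ ^ (2 ℕ.* k) * alternant toℕ ^ 1
      ≈⟨ SemiringExp.^-homo-* semiring (alternant toℕ) (2 ℕ.* k) 1 ⟨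
    alternant toℕ ^ (2 ℕ.* k ℕ.+ 1) ∎
    where
    open RingTheory (polynomialRing {n}) using (square-≈⇒^-≈; vandermonde-square)
    torsion-free : ∀ {p} → p ≋ - p → p ≋ []
    torsion-free {p} p≋-p = mk≋ λ α →
      p≡-p⇒p≡0 (≡.trans (coefficients p≋-p α) (coefficient-neg p α))

  -- The power in polynomialRawRing n is stuck on a different equality, hence not
  -- definitionally the one of polynomialRing.
  ^-polynomialRawRing : ∀ p e → RingNotation._^_ (polynomialRawRing n) p e ≡ p ^ e
  ^-polynomialRawRing p zero    = ≡.refl
  ^-polynomialRawRing p (suc e) = ≡.cong (p *_) (^-polynomialRawRing p e)
-- Averaging over the symmetric group

length-cartesianProductWith : ∀ (f : A → B → C) xs ys →
  length (cartesianProductWith f xs ys) ≡ length xs ℕ.* length ys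
length-cartesianProductWith f []       ys = ≡.refl
length-cartesianProductWith f (x ∷ xs) ys = ≡.trans (List.length-++ (List.map (f x) ys))
  (≡.cong₂ ℕ._+_ (List.length-map (f x) ys) (length-cartesianProductWith f xs ys))

length-𝔖 : ∀ n → length (𝔖 n) ≡ n !
length-𝔖 zero    = ≡.refl
length-𝔖 (suc n) = ≡.trans (length-cartesianProductWith (insert zero) (allFin (suc n)) (𝔖 n))
  (≡.cong₂ ℕ._*_ (List.length-tabulate {n = suc n} (λ i → i)) (length-𝔖 n))

-- `ℚ./` reduces to lowest terms and does not compute on variables; arithmetic with such fractions
-- is therefore checked on unnormalised ones.
toℚᵘ-/ : ∀ i d → toℚᵘ (i ℚ./ suc d) ℚᵘ.≃ mkℚᵘ i d
toℚᵘ-/ i d = ℚ.toℚᵘ-fromℚᵘ (mkℚᵘ i d)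

suc/1 : ∀ k → (+ suc k) ℚ./ 1 ≡ 1ℚ ℚ.+ (+ k) ℚ./ 1
suc/1 k = ℚ.toℚᵘ-injective (begin
  toℚᵘ ((+ suc k) ℚ./ 1)            ≈⟨ toℚᵘ-/ (+ suc k) 0 ⟩
  mkℚᵘ (+ suc k) 0                  ≈⟨ *≡* (≡.cong (ℤ._* 1ℤ) (≡.cong (λ i → 1ℤ ℤ.+ i) (≡.sym (ℤ.*-identityʳ (+ k))))) ⟩
  toℚᵘ 1ℚ ℚᵘ.+ mkℚᵘ (+ k) 0         ≈⟨ ℚᵘ.+-congʳ (toℚᵘ 1ℚ) (toℚᵘ-/ (+ k) 0) ⟨
  toℚᵘ 1ℚ ℚᵘ.+ toℚᵘ ((+ k) ℚ./ 1)   ≈⟨ ℚ.toℚᵘ-homo-+ 1ℚ ((+ k) ℚ./ 1) ⟨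
  toℚᵘ (1ℚ ℚ.+ (+ k) ℚ./ 1)         ∎)
  where open import Relation.Binary.Reasoning.Setoid ℚᵘ.≃-setoid

1/k*k : ∀ k .{{_ : NonZero k}} → (1ℤ ℚ./ k) ℚ.* ((+ k) ℚ./ 1) ≡ 1ℚ
1/k*k (suc k) = ℚ.toℚᵘ-injective (begin
  toℚᵘ ((1ℤ ℚ./ suc k) ℚ.* ((+ suc k) ℚ./ 1))          ≈⟨ ℚ.toℚᵘ-homo-* (1ℤ ℚ./ suc k) ((+ suc k) ℚ./ 1) ⟩
  toℚᵘ (1ℤ ℚ./ suc k) ℚᵘ.* toℚᵘ ((+ suc k) ℚ./ 1)      ≈⟨ ℚᵘ.*-cong (toℚᵘ-/ 1ℤ k) (toℚᵘ-/ (+ suc k) 0) ⟩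
  mkℚᵘ 1ℤ k ℚᵘ.* mkℚᵘ (+ suc k) 0                      ≈⟨ *≡* (≡.cong +_ (commutes k)) ⟩
  toℚᵘ 1ℚ                                              ∎)
  where
  open import Relation.Binary.Reasoning.Setoid ℚᵘ.≃-setoid
  commutes : ∀ k → (suc k ℕ.+ 0) ℕ.* 1 ≡ suc (k ℕ.* 1 ℕ.+ 0)
  commutes = solve-∀

∑-constant : ∀ (xs : List A) c → ℚ′.∑ xs (λ _ → c) ≡ ((+ length xs) ℚ./ 1) ℚ.* c
∑-constant []       c = ≡.sym (ℚ.*-zeroˡ c)
∑-constant (x ∷ xs) c = begin
  c ℚ.+ ℚ′.∑ xs (λ _ → c)                               ≡⟨ ≡.cong₂ ℚ._+_ (≡.sym (ℚ.*-identityˡ c)) (∑-constant xs c) ⟩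
  1ℚ ℚ.* c ℚ.+ ((+ length xs) ℚ./ 1) ℚ.* c              ≡⟨ ℚ.*-distribʳ-+ c 1ℚ ((+ length xs) ℚ./ 1) ⟨
  (1ℚ ℚ.+ (+ length xs) ℚ./ 1) ℚ.* c                    ≡⟨ ≡.cong (ℚ._* c) (suc/1 (length xs)) ⟨
  ((+ suc (length xs)) ℚ./ 1) ℚ.* c                     ∎
  where open ≡.≡-Reasoning

average : ∀ n c → ((1ℤ ℚ./ n !) {{n ℕ.!≢0}}) ℚ.* ℚ′.∑ (𝔖 n) (λ _ → c) ≡ c
average n c = begin
  ((1ℤ ℚ./ n !) {{n ℕ.!≢0}}) ℚ.* ℚ′.∑ (𝔖 n) (λ _ → c)
    ≡⟨ ≡.cong (((1ℤ ℚ./ n !) {{n ℕ.!≢0}}) ℚ.*_) (≡.trans (∑-constant (𝔖 n) c)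
         (≡.cong (λ k → ((+ k) ℚ./ 1) ℚ.* c) (length-𝔖 n))) ⟩
  ((1ℤ ℚ./ n !) {{n ℕ.!≢0}}) ℚ.* (((+ (n !)) ℚ./ 1) ℚ.* c)
    ≡⟨ ℚ.*-assoc ((1ℤ ℚ./ n !) {{n ℕ.!≢0}}) _ c ⟨
  ((1ℤ ℚ./ n !) {{n ℕ.!≢0}}) ℚ.* ((+ (n !)) ℚ./ 1) ℚ.* c
    ≡⟨ ≡.cong (ℚ._* c) (1/k*k (n !) {{n ℕ.!≢0}}) ⟩
  1ℚ ℚ.* c
    ≡⟨ ℚ.*-identityˡ c ⟩
  c ∎
  where open ≡.≡-Reasoning

-- The hyperdeterminant

indicator : Bool → ℚ
indicator b = if b then 1ℚ else 0ℚ

-- Merges the n Kronecker conditions into one test on exponent vectors; `≟ᵉ` computes to the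
-- conjunction of the entrywise tests.
∏-indicator : ∀ (u v : Fin n → ℕ) →
  ℚ′.∏ (λ i → indicator (does (u i ℕ.≟ v i))) ≡ indicator (does (tabulate u ≟ᵉ tabulate v))
∏-indicator {zero}  u v = ≡.refl
∏-indicator {suc n} u v = ≡.trans
  (≡.cong (indicator (does (u zero ℕ.≟ v zero)) ℚ.*_) (∏-indicator (u ∘ suc) (v ∘ suc)))
  (entry (does (u zero ℕ.≟ v zero)) (does (tabulate (u ∘ suc) ≟ᵉ tabulate (v ∘ suc))))
  where
  entry : ∀ a b → indicator a ℚ.* indicator b ≡ indicator (a ∧ b)
  entry true  b = ℚ.*-identityˡ _
  entry false b = ℚ.*-zeroˡ (indicator b)

exponent : Partition n → Fin n → ℕ
exponent μ i = lookup (Partition.parts μ) (opposite i) ℕ.+ toℕ i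

suc-opposite+ : ∀ (i : Fin n) → suc (toℕ (opposite i)) ℕ.+ toℕ i ≡ n
suc-opposite+ {n} i = ≡.trans (≡.sym (ℕ.+-suc (toℕ (opposite i)) (toℕ i)))
  (≡.trans (≡.cong (ℕ._+ suc (toℕ i)) (Fin.opposite-prop i)) (ℕ.m∸n+n≡m (Fin.toℕ<n i)))

oppositeSum : Vec (Permutation′ n) m → Fin n → ℕ
oppositeSum σs i = Vec.sum (Vec.map (λ σ → suc (toℕ (opposite (σ ⟨$⟩ʳ i)))) σs)

-- The one-based index of `opposite a` and the zero-based index of a add up to n. This accounts for
-- the multiple of n in the target of the delta; the additional 1 is the one-based offset of σ₀.
oppositeSum+exponents : ∀ (σs : Vec (Permutation′ n) m) i →
  oppositeSum σs i ℕ.+ exponents σs i ≡ m ℕ.* n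
oppositeSum+exponents []       i = ≡.refl
oppositeSum+exponents (σ ∷ σs) i = ≡.trans
  (interchange (suc (toℕ (opposite (σ ⟨$⟩ʳ i)))) (oppositeSum σs i) _ _)
  (≡.cong₂ ℕ._+_ (suc-opposite+ (σ ⟨$⟩ʳ i)) (oppositeSum+exponents σs i))
  where open CommutativeSemigroupProperties ℕ.+-commutativeSemigroup using (interchange)

-- Substituting conjugate σ₀ σⱼ for σⱼ turns the Kronecker condition of Δ at i into
-- exponents σs (σ₀ i) ≡ exponent l (σ₀ i); see `Δ-conjugate`.
conjugate : Permutation′ n → Permutation′ n → Permutation′ n
conjugate σ₀ σ = σ₀ ∘ₚ σ ∘ₚ reverse

-- The summand is local to `Δ` and cannot be named here, so it is an argument that unification
-- supplies in `Δ-conjugate`.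
foldr-zeros : ∀ (summand : Decreasing n → Fin n → ℤ) → (∀ i → summand (zeros n) i ≡ one-based i) →
  ∀ σ₀ (σs : Vec (Permutation′ n) m) i →
  Vec.foldr′ ℤ._+_ 0ℤ (zipWith summand (replicate m (zeros n)) (Vec.map (_⟨$⟩ʳ i) (Vec.map (conjugate σ₀) σs)))
    ≡ + oppositeSum σs (σ₀ ⟨$⟩ʳ i)
foldr-zeros summand eq σ₀ []       i = ≡.refl
foldr-zeros summand eq σ₀ (σ ∷ σs) i = ≡.cong₂ ℤ._+_ (eq _) (foldr-zeros summand eq σ₀ σs i)

-- Here p is a part of λ, s the value of σ₀, o the reversed indices and e the exponent: p + (s + 1)
-- + o = N + 1 with N = o + e cancels to e = p + s.
δ-shift : ∀ p s o e N → o ℕ.+ e ≡ N →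
  δ (((+ p) ℤ.+ (+ suc s)) ℤ.+ (+ o)) ((+ N) ℤ.+ 1ℤ) ≡ indicator (does (e ℕ.≟ p ℕ.+ s))
δ-shift p s o e N ≡.refl = ≡.cong indicator (does-⇔
  (mk⇔ (λ eq → ℕ.+-cancelˡ-≡ o e (p ℕ.+ s) (ℕ.suc-injective (≡.trans (≡.sym (ℕ.+-comm (o ℕ.+ e) 1))
                 (≡.trans (≡.sym (ℤ.+-injective eq)) (rearrange p s o)))))
       (λ { ≡.refl → ≡.cong +_ (≡.trans (rearrange p s o) (≡.sym (ℕ.+-comm (o ℕ.+ (p ℕ.+ s)) 1))) }))
  ((((+ p) ℤ.+ (+ suc s)) ℤ.+ (+ o)) ℤ.≟ ((+ (o ℕ.+ e)) ℤ.+ 1ℤ)) (e ℕ.≟ p ℕ.+ s))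
  where
  rearrange : ∀ p s o → p ℕ.+ suc s ℕ.+ o ≡ suc (o ℕ.+ (p ℕ.+ s))
  rearrange = solve-∀

Δ-conjugate : ∀ (l : Partition n) σ₀ (σs : Vec (Permutation′ n) m) i →
  Δ n (suc m) (toDecreasing l ∷ replicate m (zeros n))
    (Vec.map (_⟨$⟩ʳ i) (σ₀ ∷ Vec.map (conjugate σ₀) σs))
    ≡ indicator (does (exponents σs (σ₀ ⟨$⟩ʳ i) ℕ.≟ exponent l (σ₀ ⟨$⟩ʳ i)))
Δ-conjugate {n} {m} l σ₀ σs i = ≡.trans
  (≡.cong₂ δ
    (≡.cong₂ ℤ._+_
      (≡.cong (ℤ._+ one-based s) (Vec.lookup-map (opposite s) +_ (Partition.parts l)))
      (foldr-zeros _ (λ j → ≡.trans (≡.cong (ℤ._+ one-based j) (Vec.lookup-replicate (opposite j) 0ℤ))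
                                    (ℤ.+-identityˡ _)) σ₀ σs i))
    (≡.cong (ℤ._+ 1ℤ) (≡.sym (ℤ.pos-* m n))))
  (δ-shift (lookup (Partition.parts l) (opposite s)) (toℕ s) (oppositeSum σs s) (exponents σs s)
    (m ℕ.* n) (oppositeSum+exponents σs s))
  where s = σ₀ ⟨$⟩ʳ i

signs-conjugate : ∀ σ₀ (σs : Vec (Permutation′ n) m) →
  signs (Vec.map (conjugate σ₀) σs) ≡ (ℚ′.sign σ₀ ℚ.* ℚ′.sign {n} reverse) ℚ′.^ m ℚ.* signs σs
signs-conjugate σ₀ []       = ≡.refl
signs-conjugate {n} {suc m} σ₀ (σ ∷ σs) = begin
  ℚ′.sign (conjugate σ₀ σ) ℚ.* signs (Vec.map (conjugate σ₀) σs)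
    ≡⟨ ≡.cong₂ ℚ._*_ sign-conjugate (signs-conjugate σ₀ σs) ⟩
  (x ℚ.* ℚ′.sign σ) ℚ.* (x ℚ′.^ m ℚ.* signs σs)
    ≡⟨ interchange x (ℚ′.sign σ) (x ℚ′.^ m) (signs σs) ⟩
  (x ℚ.* x ℚ′.^ m) ℚ.* (ℚ′.sign σ ℚ.* signs σs) ∎
  where
  open ≡.≡-Reasoning
  open CommutativeSemigroupProperties (CommutativeRing.*-commutativeSemigroup ℚ.+-*-commutativeRing)
    using (interchange; x∙yz≈xz∙y)
  x = ℚ′.sign σ₀ ℚ.* ℚ′.sign {n} reverse

  sign-conjugate : ℚ′.sign (conjugate σ₀ σ) ≡ x ℚ.* ℚ′.sign σ
  sign-conjugate = ≡.trans (ℚR.sign-∘ σ₀ (σ ∘ₚ reverse))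
    (≡.trans (≡.cong (ℚ′.sign σ₀ ℚ.*_) (ℚR.sign-∘ σ reverse)) (x∙yz≈xz∙y (ℚ′.sign σ₀) (ℚ′.sign σ) (ℚ′.sign {n} reverse)))

map-cong-≈ᵛ : ∀ (h : Permutation′ n → A) → (∀ {π ρ} → π Perm.≈ ρ → h π ≡ h ρ) →
  ∀ {σs τs : Vec (Permutation′ n) m} → σs ≈ᵛ τs → Vec.map h σs ≡ Vec.map h τs
map-cong-≈ᵛ h h-resp {[]}     {[]}     eq = ≡.refl
map-cong-≈ᵛ h h-resp {σ ∷ σs} {τ ∷ τs} eq =
  ≡.cong₂ _∷_ (h-resp {σ} {τ} (eq zero)) (map-cong-≈ᵛ h (λ {π} {ρ} → h-resp {π} {ρ}) {σs} {τs} (eq ∘ suc))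

Det-summand : (Vec (Fin n) m → ℚ) → Vec (Permutation′ n) m → ℚ
Det-summand M σs = ℚ′.sign (Vec.foldr′ _∘ₚ_ Perm.id σs) ℚ.* ℚ′.∏ λ i → M (Vec.map (_⟨$⟩ʳ i) σs)

-- Needed for reindexing. Factoring the sign of the composite first lets the coordinates be compared
-- one at a time.
Det-summand-resp : ∀ (M : Vec (Fin n) m → ℚ) {σs τs} → σs ≈ᵛ τs → Det-summand M σs ≡ Det-summand M τs
Det-summand-resp M {σs} {τs} eq = ≡.cong₂ ℚ._*_
  (≡.trans (ℚR.sign-foldr σs) (≡.trans
    (≡.cong (Vec.foldr′ ℚ._*_ 1ℚ) (map-cong-≈ᵛ ℚ′.sign (λ {π} {ρ} → ℚR.sign-cong {π = π} {ρ}) {σs} {τs} eq))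
    (≡.sym (ℚR.sign-foldr τs))))
  (ℚR.∏-cong λ i → ≡.cong M (map-cong-≈ᵛ (_⟨$⟩ʳ i) (λ eq → eq i) {σs} {τs} eq))

𝔇-partition : ∀ (l : Partition n) k →
  𝔇 (toDecreasing l ∷ replicate (2 ℕ.* k ℕ.+ 1) (zeros n)) ≡
  ℚ′.sign {n} reverse ℚ.* ℚ′.∑ (tuples (𝔖 n) (2 ℕ.* k ℕ.+ 1)) λ σs →
    if does (tabulate (exponents σs) ≟ᵉ tabulate (exponent l)) then signs σs else 0ℚ
𝔇-partition {n} l k = ≡.trans
  (≡.cong (((1ℤ ℚ./ n !) {{n ℕ.!≢0}}) ℚ.*_) (≡.trans
    (ℚR.∑-cartesianProductWith _∷_ (𝔖 n) (tuples (𝔖 n) N) T)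
    (ℚR.∑-cong (𝔖 n) constant)))
  (average n _)
  where
  open ≡.≡-Reasoning
  N = 2 ℕ.* k ℕ.+ 1
  w = ℚ′.sign {n} reverse

  M : Vec (Fin n) (suc N) → ℚ
  M = Δ n (suc N) (toDecreasing l ∷ replicate N (zeros n))

  T : Vec (Permutation′ n) (suc N) → ℚ
  T = Det-summand M

  U : Vec (Permutation′ n) N → ℚ
  U σs = if does (tabulate (exponents σs) ≟ᵉ tabulate (exponent l)) then signs σs else 0ℚ

  -- The evenness of the order 2k + 2 enters here: the sign of σ₀ occurs an even number of times and
  -- w an odd number.
  sign-part : ∀ σ₀ (σs : Vec (Permutation′ n) N) →
    ℚ′.sign (Vec.foldr′ _∘ₚ_ Perm.id (σ₀ ∷ Vec.map (conjugate σ₀) σs)) ≡ w ℚ.* signs σs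
  sign-part σ₀ σs = begin
    ℚ′.sign (Vec.foldr′ _∘ₚ_ Perm.id (σ₀ ∷ Vec.map (conjugate σ₀) σs))
      ≡⟨ ℚR.sign-foldr (σ₀ ∷ Vec.map (conjugate σ₀) σs) ⟩
    s ℚ.* signs (Vec.map (conjugate σ₀) σs)
      ≡⟨ ≡.cong (s ℚ.*_) (≡.trans (signs-conjugate σ₀ σs)
           (≡.cong (ℚ._* signs σs) (ℚR.square-one⇒^-odd sw² k))) ⟩
    s ℚ.* ((s ℚ.* w) ℚ.* signs σs)
      ≡⟨ ℚ.*-assoc s (s ℚ.* w) (signs σs) ⟨
    (s ℚ.* (s ℚ.* w)) ℚ.* signs σs
      ≡⟨ ≡.cong (ℚ._* signs σs) (≡.trans (≡.sym (ℚ.*-assoc s s w))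
           (≡.trans (≡.cong (ℚ._* w) (ℚR.sign-square σ₀)) (ℚ.*-identityˡ w))) ⟩
    w ℚ.* signs σs ∎
    where
    open CommutativeSemigroupProperties (CommutativeRing.*-commutativeSemigroup ℚ.+-*-commutativeRing)
      using (interchange)
    s = ℚ′.sign σ₀
    sw² : (s ℚ.* w) ℚ.* (s ℚ.* w) ≡ 1ℚ
    sw² = ≡.trans (interchange s w s w)
      (≡.cong₂ ℚ._*_ (ℚR.sign-square σ₀) (ℚR.sign-square {n} reverse))

  product-part : ∀ σ₀ (σs : Vec (Permutation′ n) N) →
    ℚ′.∏ (λ i → M (Vec.map (_⟨$⟩ʳ i) (σ₀ ∷ Vec.map (conjugate σ₀) σs))) ≡
    indicator (does (tabulate (exponents σs) ≟ᵉ tabulate (exponent l)))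
  product-part σ₀ σs = begin
    ℚ′.∏ (λ i → M (Vec.map (_⟨$⟩ʳ i) (σ₀ ∷ Vec.map (conjugate σ₀) σs)))
      ≡⟨ ℚR.∏-cong (Δ-conjugate l σ₀ σs) ⟩
    ℚ′.∏ (λ i → indicator (does (exponents σs (σ₀ ⟨$⟩ʳ i) ℕ.≟ exponent l (σ₀ ⟨$⟩ʳ i))))
      -- The condition at i depends on σ₀ i alone, so reordering the factors eliminates σ₀.
      ≡⟨ ℚR.∏-permute (λ i → indicator (does (exponents σs i ℕ.≟ exponent l i))) σ₀ ⟨
    ℚ′.∏ (λ i → indicator (does (exponents σs i ℕ.≟ exponent l i)))
      ≡⟨ ∏-indicator (exponents σs) (exponent l) ⟩
    indicator (does (tabulate (exponents σs) ≟ᵉ tabulate (exponent l))) ∎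

  *-indicator : ∀ x b → x ℚ.* indicator b ≡ (if b then x else 0ℚ)
  *-indicator x true  = ℚ.*-identityʳ x
  *-indicator x false = ℚ.*-zeroʳ x

  conjugation : ∀ σ₀ → Inverse (permutationSetoid n) (permutationSetoid n)
  conjugation σ₀ = ∘ₚ-inverse σ₀ reverse

  constant : ∀ σ₀ → (ℚ′.∑ (tuples (𝔖 n) N) λ σs → T (σ₀ ∷ σs)) ≡ w ℚ.* ℚ′.∑ (tuples (𝔖 n) N) U
  constant σ₀ = begin
    (ℚ′.∑ (tuples (𝔖 n) N) λ σs → T (σ₀ ∷ σs))
      ≡⟨ ℚR.∑-tuples-reindex (conjugation σ₀) N (λ σs → T (σ₀ ∷ σs))
           (λ {σs} {τs} eq → Det-summand-resp M {σ₀ ∷ σs} {σ₀ ∷ τs} λ { zero _ → ≡.refl ; (suc j) → eq j }) ⟨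
    (ℚ′.∑ (tuples (𝔖 n) N) λ σs → T (σ₀ ∷ Vec.map (conjugate σ₀) σs))
      ≡⟨ ℚR.∑-cong (tuples (𝔖 n) N) (λ σs → ≡.trans
           (≡.cong₂ ℚ._*_ (sign-part σ₀ σs) (product-part σ₀ σs))
           (≡.trans (ℚ.*-assoc w (signs σs) _)
             (≡.cong (w ℚ.*_) (*-indicator (signs σs) (does (tabulate (exponents σs) ≟ᵉ tabulate (exponent l))))))) ⟩
    (ℚ′.∑ (tuples (𝔖 n) N) λ σs → w ℚ.* U σs)
      ≡⟨ ℚR.*-distribˡ-∑ (tuples (𝔖 n) N) w U ⟨
    w ℚ.* ℚ′.∑ (tuples (𝔖 n) N) U ∎

-- Strictly increasing exponent sequences

StrictlyMonotone : (Fin n → Fin n) → Set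
StrictlyMonotone f = ∀ i j → i < j → f i < f j

strictlyMonotone⇒inflationary : ∀ (f : Fin n → Fin n) → StrictlyMonotone f → ∀ i → toℕ i ℕ.≤ toℕ (f i)
strictlyMonotone⇒inflationary {suc n} f f-mono = <-weakInduction (λ i → toℕ i ℕ.≤ toℕ (f i)) z≤n
  λ i i≤fi → ℕ.≤-<-trans (≡.subst (ℕ._≤ toℕ (f (inject₁ i))) (Fin.toℕ-inject₁ i) i≤fi)
    (f-mono (inject₁ i) (suc i) (s≤s (ℕ.≤-reflexive (Fin.toℕ-inject₁ i))))

-- Inflation of π gives i ≤ π i. The inverse is increasing too, and its inflation at π i gives π i ≤
-- i.
strictlyMonotone⇒id : ∀ (π : Permutation′ n) → StrictlyMonotone (π ⟨$⟩ʳ_) → Perm.id Perm.≈ π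
strictlyMonotone⇒id π π-mono i = Fin.toℕ-injective (ℕ.≤-antisym
  (strictlyMonotone⇒inflationary (π ⟨$⟩ʳ_) π-mono i)
  (≡.subst (λ j → toℕ (π ⟨$⟩ʳ i) ℕ.≤ toℕ j) (inverseˡ π)
    (strictlyMonotone⇒inflationary (π ⟨$⟩ˡ_) inverse-mono (π ⟨$⟩ʳ i))))
  where
  inverse-mono : StrictlyMonotone (π ⟨$⟩ˡ_)
  inverse-mono a b a<b with Fin.<-cmp (π ⟨$⟩ˡ a) (π ⟨$⟩ˡ b)
  ... | tri< p _ _  = p
  ... | tri≈ _ eq _ = contradiction a<b (ℕ.<-irrefl (≡.cong toℕ (permutation-injective (flip π) eq)))
  ... | tri> _ _ q  = contradiction a<b (ℕ.<⇒≯ (≡.subst₂ _<_ (inverseʳ π) (inverseʳ π) (π-mono _ _ q)))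

-- Read backwards the parts weakly increase, and adding i makes the increase strict.
exponent-mono : ∀ (μ : Partition n) i j → i < j → exponent μ i ℕ.< exponent μ j
exponent-mono μ i j i<j = ℕ.+-mono-≤-<
  (Linked.lookup⁺ (λ x≥y y≥z → ℕ.≤-trans y≥z x≥y) (Partition.sorted μ) (opposite-< i j i<j)) i<j

-- Supports are compared by ≡ on partitions, which carry a proof of sortedness; that proof is
-- unique.
partition-≡ : ∀ {μ l : Partition n} → Partition.parts μ ≡ Partition.parts l → μ ≡ l
partition-≡ {μ = partition parts p} {partition .parts q} ≡.refl =
  ≡.cong (partition parts) (Linked.irrelevant ℕ.≤-irrelevant p q)

infix 4 _≟ᵖ_
_≟ᵖ_ : DecidableEquality (Partition n)
μ ≟ᵖ l = map′ partition-≡ (≡.cong Partition.parts) (Partition.parts μ ≟ᵉ Partition.parts l)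

exponent-injective : ∀ {μ l : Partition n} → (∀ i → exponent μ i ≡ exponent l i) → μ ≡ l
exponent-injective {μ = μ} {l} eq = partition-≡ (≡.trans (≡.sym (Vec.tabulate∘lookup (Partition.parts μ)))
  (≡.trans (Vec.tabulate-cong λ i → ≡.subst
      (λ j → lookup (Partition.parts μ) j ≡ lookup (Partition.parts l) j) (Fin.opposite-involutive i)
      (ℕ.+-cancelʳ-≡ (toℕ (opposite i)) _ _ (eq (opposite i))))
    (Vec.tabulate∘lookup (Partition.parts l))))

-- π is strictly monotone because both exponent sequences are strictly increasing.
exponent-permuted⇒id : ∀ (μ l : Partition n) π →
  (∀ i → exponent μ (π ⟨$⟩ʳ i) ≡ exponent l i) → Perm.id Perm.≈ π
exponent-permuted⇒id μ l π eq = strictlyMonotone⇒id π λ i j i<j → mono i j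
  (≡.subst₂ ℕ._<_ (≡.sym (eq i)) (≡.sym (eq j)) (exponent-mono l i j i<j))
  where
  mono : ∀ i j → exponent μ (π ⟨$⟩ʳ i) ℕ.< exponent μ (π ⟨$⟩ʳ j) → (π ⟨$⟩ʳ i) < (π ⟨$⟩ʳ j)
  mono i j e< with Fin.<-cmp (π ⟨$⟩ʳ i) (π ⟨$⟩ʳ j)
  ... | tri< p _ _  = p
  ... | tri≈ _ πi≡πj _ = contradiction e< (ℕ.<-irrefl (≡.cong (exponent μ) πi≡πj))
  ... | tri> _ _ q  = contradiction e< (ℕ.<⇒≯ (exponent-mono μ _ _ q))

-- Reading off the coefficients of a Schur expansion

module _ {n : ℕ} where
  open CommutativeRing (polynomialRing {n})
    using (setoid; reflexive; trans; *-congˡ; *-congʳ; *-assoc)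
  open RawRing (polynomialRawRing n) using (_*_)
  open RingTheory (polynomialRing {n}) using (∑-cong; *-distribʳ-∑; det-cong)
  open SetoidReasoning setoid

  schur-*-alternant : ∀ {μ s} → IsSchurPolynomial μ s → s * alternant toℕ ≋ alternant (exponent μ)
  schur-*-alternant {μ} {s} s-schur = begin
    s * alternant toℕ                     ≈⟨ *-congˡ {s} (alternant-raw toℕ) ⟨
    s * alternantRaw toℕ                  ≈⟨ mk≋ s-schur ⟩
    alternantRaw (exponent μ)             ≈⟨ alternant-raw (exponent μ) ⟩
    alternant (exponent μ)                ∎
    where
    open RingNotation (polynomialRawRing n) using (det; _^_)

    alternantRaw : (Fin n → ℕ) → Polynomial n
    alternantRaw e = det λ i j → z i ^ e j

    alternant-raw : ∀ e → alternantRaw e ≋ alternant e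
    alternant-raw e = det-cong λ i j → reflexive (^-polynomialRawRing (z i) (e j))

  expansion-*-alternant : ∀ {s : Partition n → Polynomial n} → (∀ μ → IsSchurPolynomial μ (s μ)) →
    ∀ {f g} (f-expansion : IsSchurExpansion s f g) →
    f * alternant toℕ ≋
      ℚ[z].∑ (IsSchurExpansion.support f-expansion) λ μ → const (g μ) * alternant (exponent μ)
  expansion-*-alternant {s} s-schur {f} {g} f-expansion = begin
    f * alternant toℕ
      ≈⟨ *-congʳ {alternant toℕ} (mk≋ {p = f} {q = ℚ[z].∑ support gs} expansion) ⟩
    ℚ[z].∑ support gs * alternant toℕ
      ≈⟨ *-distribʳ-∑ support (alternant toℕ) gs ⟩
    (ℚ[z].∑ support λ μ → gs μ * alternant toℕ)
      ≈⟨ ∑-cong support (λ μ → trans (*-assoc (const (g μ)) (s μ) (alternant toℕ))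
           (*-congˡ {const (g μ)} (schur-*-alternant {μ} {s μ} (s-schur μ)))) ⟩
    (ℚ[z].∑ support λ μ → const (g μ) * alternant (exponent μ)) ∎
    where
    open IsSchurExpansion f-expansion
    gs : Partition n → Polynomial n
    gs μ = const (g μ) * s μ

module _ {n : ℕ} where
  open ≡.≡-Reasoning
  open RawRing (polynomialRawRing n) using () renaming (_*_ to infixl 7 _*ᵖ_)

  -- A permutation matching the exponents of μ with those of l must be the identity, and then μ = l.
  coefficient-alternant-≢ : ∀ {μ l : Partition n} → μ ≢ l →
    coefficient (alternant (exponent μ)) (tabulate (exponent l)) ≡ 0ℚ
  coefficient-alternant-≢ {μ} {l} μ≢l = ≡.trans (coefficient-alternant (exponent μ) _)
    (ℚR.∑-zero (𝔖 n) λ π _ → if-no (tabulate (λ i → exponent μ (π ⟨$⟩ʳ i)) ≟ᵉ tabulate (exponent l))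
      λ eq → μ≢l (exponent-injective λ i →
        let pointwise = tabulate-injective eq
        in ≡.trans (≡.cong (exponent μ) (exponent-permuted⇒id μ l π pointwise i)) (pointwise i)))

  coefficient-alternant-self : ∀ (l : Partition n) →
    coefficient (alternant (exponent l)) (tabulate (exponent l)) ≡ 1ℚ
  coefficient-alternant-self l = begin
    coefficient (alternant (exponent l)) (tabulate (exponent l))
      ≡⟨ coefficient-alternant (exponent l) _ ⟩
    ℚ′.∑ (𝔖 n) F
      ≡⟨ ℚR.∑-𝔖-single F (λ {π} {ρ} → F-resp {π} {ρ}) Perm.id
           (λ π id≉π → if-no (permuted π ≟ᵉ tabulate (exponent l))
             λ eq → id≉π (exponent-permuted⇒id l l π (tabulate-injective eq))) ⟩
    F Perm.id
      ≡⟨ if-yes (permuted Perm.id ≟ᵉ tabulate (exponent l)) ≡.refl ⟩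
    ℚ′.sign {n} Perm.id
      ≡⟨ ℚR.sign-id {n} ⟩
    1ℚ ∎
    where
    permuted : Permutation′ n → Vec ℕ n
    permuted π = tabulate λ i → exponent l (π ⟨$⟩ʳ i)

    F : Permutation′ n → ℚ
    F π = if does (permuted π ≟ᵉ tabulate (exponent l)) then ℚ′.sign π else 0ℚ

    F-resp : ℚR.Respects≈ F
    F-resp {π} {ρ} π≈ρ = ≡.cong₂ (λ α s → if does (α ≟ᵉ tabulate (exponent l)) then s else 0ℚ)
      (Vec.tabulate-cong λ i → ≡.cong (exponent l) (π≈ρ i)) (ℚR.sign-cong {π = π} {ρ} π≈ρ)

  ∑-coefficient-alternant : ∀ {support : List (Partition n)} {g : Partition n → ℚ} →
    Unique support → (∀ μ → μ ∉ support → g μ ≡ 0ℚ) → ∀ l →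
    ℚ′.∑ support (λ μ → g μ ℚ.* coefficient (alternant (exponent μ)) (tabulate (exponent l))) ≡ g l
  ∑-coefficient-alternant {support} {g} unique vanishesOutside l
    with DecMembership._∈?_ _≟ᵖ_ l support
  ... | yes l∈ = ≡.trans
    (ℚR.∑-single ≡.sym unique l∈
      (λ μ → g μ ℚ.* coefficient (alternant (exponent μ)) (tabulate (exponent l)))
      λ μ l≢μ → ≡.trans
        (≡.cong (g μ ℚ.*_) (coefficient-alternant-≢ {μ} {l} (l≢μ ∘ ≡.sym))) (ℚ.*-zeroʳ (g μ)))
    (≡.trans (≡.cong (g l ℚ.*_) (coefficient-alternant-self l)) (ℚ.*-identityʳ (g l)))
  -- Off the support every summand has μ ≠ l and vanishes, and g l is 0 as well.
  ... | no  l∉ = ≡.trans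
    (ℚR.∑-zero support λ μ μ∈ → ≡.trans
      (≡.cong (g μ ℚ.*_) (coefficient-alternant-≢ {μ} {l} λ { ≡.refl → l∉ μ∈ })) (ℚ.*-zeroʳ (g μ)))
    (≡.sym (vanishesOutside l l∉))

  schurCoefficient : ∀ {s : Partition n → Polynomial n} → (∀ μ → IsSchurPolynomial μ (s μ)) →
    ∀ {f g} → IsSchurExpansion s f g → ∀ l →
    g l ≡ coefficient (f *ᵖ alternant toℕ) (tabulate (exponent l))
  schurCoefficient {s} s-schur {f} {g} f-expansion l = ≡.sym (begin
    coefficient (f *ᵖ alternant toℕ) α
      ≡⟨ coefficients (expansion-*-alternant s-schur f-expansion) α ⟩
    coefficient (ℚ[z].∑ support λ μ → const (g μ) *ᵖ alternant (exponent μ)) α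
      ≡⟨ coefficient-∑ support (λ μ → const (g μ) *ᵖ alternant (exponent μ)) α ⟩
    (ℚ′.∑ support λ μ → coefficient (const (g μ) *ᵖ alternant (exponent μ)) α)
      ≡⟨ ℚR.∑-cong support (λ μ → coefficient-const-* (g μ) (alternant (exponent μ)) α) ⟩
    (ℚ′.∑ support λ μ → g μ ℚ.* coefficient (alternant (exponent μ)) α)
      ≡⟨ ∑-coefficient-alternant unique vanishesOutside l ⟩
    g l ∎)
    where
    open IsSchurExpansion f-expansion
    α = tabulate (exponent l)

open import Data.Nat.Base using (_≤_; _+_; _*_; _∸_)
open import Data.Nat.DivMod using (_/_)

corollary4p3 : (n k : ℕ) → 1 ≤ n → 1 ≤ k →
    (s : Partition n → Polynomial n) → (∀ μ → IsSchurPolynomial μ (s μ)) →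
    (g : Partition n → ℚ) →
    IsSchurExpansion s (RingNotation._^_ (polynomialRawRing n) V (2 * k)) g →
    (l : Partition n) →
    g l ≡ ((ℚ.- 1ℚ) ℚ′.^ (n * (n ∸ 1) / 2)) ℚ.* 𝔇 (toDecreasing l ∷ replicate (2 * k + 1) (zeros n))
corollary4p3 n k _ _ s s-schur g V^2k-expansion l = begin
  g l
    ≡⟨ schurCoefficient s-schur V^2k-expansion l ⟩
  coefficient ((RingNotation._^_ (polynomialRawRing n) V (2 * k)) *ᵖ alternant toℕ) α
    ≡⟨ ≡.cong (λ p → coefficient (p *ᵖ alternant toℕ) α) (^-polynomialRawRing V (2 * k)) ⟩
  coefficient ((V ^ (2 * k)) *ᵖ alternant toℕ) α
    ≡⟨ coefficients (V^2k*alternant k) α ⟩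
  coefficient (alternant toℕ ^ (2 * k + 1)) α
    ≡⟨ coefficient-alternant-^ (2 * k + 1) α ⟩
  signedCount
    -- As w² = 1, the factor w can be inserted twice: one copy becomes (-1)^(n(n-1)/2), the other is
    -- absorbed by the hyperdeterminant.
    ≡⟨ ≡.trans (≡.sym (ℚ.*-assoc w w signedCount))
         (≡.trans (≡.cong (ℚ._* signedCount) (ℚR.sign-square {n} reverse)) (ℚ.*-identityˡ signedCount)) ⟨
  w ℚ.* (w ℚ.* signedCount)
    ≡⟨ ≡.cong₂ ℚ._*_ (ℚR.sign-reverse n) (≡.sym (𝔇-partition l k)) ⟩
  ((ℚ.- 1ℚ) ℚ′.^ (n * (n ∸ 1) / 2)) ℚ.* 𝔇 (toDecreasing l ∷ replicate (2 * k + 1) (zeros n)) ∎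
  where
  open ≡.≡-Reasoning
  open ℚ[z] {n} using (_^_)
  open RawRing (polynomialRawRing n) using () renaming (_*_ to infixl 7 _*ᵖ_)
  α = tabulate (exponent l)
  w = ℚ′.sign {n} reverse
  signedCount = ℚ′.∑ (tuples (𝔖 n) (2 * k + 1)) λ σs →
    if does (tabulate (exponents σs) ≟ᵉ α) then signs σs else 0ℚ
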